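{- A permutation $w \in \mathfrak{S}_n$ is a prism if and only if there exists $i \in \textsf{supp}(w)$ that is unconfined in the reduced words of $w$; that is, if and only if there exist a letter $i$ and a reduced word $s$ of $w$ such that $i$ appears exactly once in $s$, and this occurrence of $i$ lies neither between two occurrences of $i+1$ nor between two occurrences of $i-1$ in $s$.
   Context: $\sigma_i$ ($1\le i\le n-1$) is the simple transposition swapping $i$ and $i+1$; products are compositions of maps. A reduced word of $w$ is a word $i_1\cdots i_\ell$ of minimal length with $w=\sigma_{i_1}\cdots\sigma_{i_\ell}$. $\textsf{supp}(w)$ is the set of letters appearing in (any) reduced word of $w$. Bruhat order: $u \preceq w$ iff some reduced word of $u$ is a subword of some reduced word of $w$; $B(w)=\{u:u\preceq w\}$. A permutation $w$ is a prism if $B(w) \cong \mathbf{2} \times X$ as posets for some poset $X$, where $\mathbf{2}$ is the two-element chain (equivalently, $B(w)\cong B\times X$ for some nontrivial boolean algebra $B$). -}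

module Defs where

open import Level using (0ℓ; suc)
open import Data.Bool.Properties using () renaming (≤-poset to 𝟐)
open import Data.Fin using (Fin; toℕ; inject₁)
open import Data.Fin.Permutation as Perm
  using (Permutation′; transpose; _∘ₚ_; _≈_)
open import Data.List using (List; []; _∷_; _++_; foldr; length)
open import Data.List.Membership.Propositional using (_∈_; _∉_)
open import Data.List.Relation.Binary.Sublist.Propositional using (_⊆_)
open import Data.Nat as ℕ using (ℕ; pred; _≤_)
open import Data.Product using (Σ; Σ-syntax; ∃; ∃-syntax; ∃₂; _×_; proj₁)
open import Data.Product.Relation.Binary.Pointwise.NonDependent using (×-poset)
open import Function using (_on_)
open import Relation.Binary.Bundles using (Poset)
open import Relation.Binary.Core using (Rel)
open import Relation.Binary.Morphism.Structures using (IsOrderIsomorphism)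
open import Relation.Binary.PropositionalEquality using (_≡_)
open import Relation.Nullary using (¬_)

private
  variable
    n : ℕ

-- Points and letters are numbered from 0: the letter k is the informal letter
-- k + 1.  The letters of 𝔖₀ and 𝔖₁ form the empty type Fin 0.
Letter : ℕ → Set
Letter n = Fin (pred n)

Word : ℕ → Set
Word n = List (Letter n)

σ : Letter n → Permutation′ n
σ {ℕ.suc _} i = transpose (inject₁ i) (Fin.suc i)

-- σ_{i₁} ∘ ⋯ ∘ σ_{iₗ} as a composition of maps.  The library's _∘ₚ_ is
-- diagrammatic (π ∘ₚ ρ applies π first), hence the reversal.
⟦_⟧ : Word n → Permutation′ n
⟦_⟧ = foldr (λ i π → π ∘ₚ σ i) Perm.id

IsReducedWord : Word n → Permutation′ n → Set
IsReducedWord s w = ⟦ s ⟧ ≈ w × (∀ t → ⟦ t ⟧ ≈ w → length s ≤ length t)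

_∈supp_ : Letter n → Permutation′ n → Set
i ∈supp w = ∃[ s ] (IsReducedWord s w × i ∈ s)

-- Subwords need not be contiguous: _⊆_ is the library's order-preserving
-- sublist relation.
_⪯_ : Rel (Permutation′ n) 0ℓ
u ⪯ w = ∃₂ λ s t → IsReducedWord s u × IsReducedWord t w × s ⊆ t

-- The underlying set of B(w); elements are compared through proj₁ only, so the
-- choice of witness of u ⪯ w is irrelevant.
B : Permutation′ n → Set
B {n} w = Σ[ u ∈ Permutation′ n ] u ⪯ w

-- B(w) ≅ 𝟐 × X, with 𝟐 the chain false ≤ true.  IsOrderIsomorphism asks only for
-- the relations on B(w), so that they form a partial order need not be shown
-- first.  Equality in X is an arbitrary equivalence relation.
IsPrism : Permutation′ n → Set (suc 0ℓ)
IsPrism w =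
  Σ[ X ∈ Poset 0ℓ 0ℓ 0ℓ ]
    let module 𝟐×X = Poset (×-poset 𝟐 X) in
    Σ[ f ∈ (B w → 𝟐×X.Carrier) ]
      IsOrderIsomorphism (_≈_ on proj₁) 𝟐×X._≈_ (_⪯_ on proj₁) 𝟐×X._≤_ f

-- i occurs exactly once in s = a i b, and for j = i + 1 or j = i − 1 (when these
-- are letters) j does not occur on both sides of it.  The letters come from Fin n
-- for an arbitrary n, since n cannot be recovered from Fin (pred n).
UnconfinedIn : Fin n → List (Fin n) → Set
UnconfinedIn i s = ∃₂ λ a b →
  s ≡ a ++ i ∷ b ×
  i ∉ a × i ∉ b ×
  (∀ j → toℕ j ≡ ℕ.suc (toℕ i) → ¬ (j ∈ a × j ∈ b)) ×
  (∀ j → ℕ.suc (toℕ j) ≡ toℕ i → ¬ (j ∈ a × j ∈ b))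

Unconfined : Letter n → Permutation′ n → Set
Unconfined i w = ∃[ s ] (IsReducedWord s w × UnconfinedIn i s)

-- By strong exchange, ⪯ is the order generated by the reflections that create an inversion;
-- the lifting property gives the subword property and a reduced coatom above every u ≺ w.
--
-- If B(w) ≅ 𝟐 × X, the atom (1, min X) is some σᵢ, and (0, max X) corresponds to an element v
-- that is not above σᵢ.  A coatom of B(w) above v, obtained from a reduced word of w by
-- deleting one letter, avoids i; hence the deleted letter is the only i in that word.  If a
-- neighbour j of i occurred on both sides of it, σᵢσⱼ and σⱼσᵢ would lie in B(w), and σᵢ and σⱼ
-- would have no join, although (1, min X) has a join with every element of 𝟐 × X.
--
-- Conversely, let a i b be reduced with i unconfined.  The letters below i all commute with i
-- either in a or in b, and so do those above i.  Moving them across i gives a reduced word p i q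
-- of w in which the letters of p and q come from disjoint sides.  Then x iᵋ y ↦ (ε , x , y) is
-- an isomorphism of B(w) with 𝟐 × B(p) × B(q), since such factorizations are unique.

module Submission where

open import Defs
open import Data.Bool as Bool using (Bool; true; false)
import Data.Bool.Properties as Bool
open import Data.Empty using (⊥; ⊥-elim)
open import Data.Fin as Fin using (Fin; toℕ; inject₁; _<_)
import Data.Fin.Permutation.Components as PC
open import Data.Fin.Permutation as Perm
  using (Permutation′; transpose; _∘ₚ_; _⟨$⟩ʳ_; _⟨$⟩ˡ_; inverseˡ; inverseʳ)
import Data.Fin.Properties as Fin
open import Data.Fin.Permutation.Transposition.List
  using (TranspositionList; eval; decompose; eval-decompose)
open import Data.List using (List; []; _∷_; _++_; length)
open import Data.List.Membership.Propositional using (_∈_; _∉_; find; lose)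
open import Data.List.Membership.Propositional.Properties
  using (∈-++⁺ˡ; ∈-++⁺ʳ; ∈-++⁻; ∈-insert)
open import Data.List.Properties using (length-++)
open import Data.List.Relation.Binary.Pointwise using (Pointwise-≡⇒≡)
open import Data.List.Relation.Binary.Sublist.Propositional
  using (_⊆_; []; _∷_; _∷ʳ_; ⊆-refl; ⊆-trans; minimum; from∈)
open import Data.List.Relation.Binary.Sublist.Propositional.Properties
  using (All-resp-⊆; Any-resp-⊆; ++⁺)
open import Data.List.Relation.Binary.Sublist.Heterogeneous.Properties
  using (length-mono-≤; toPointwise)
open import Data.List.Relation.Unary.All as All using (All; []; _∷_)
import Data.List.Relation.Unary.All.Properties as All
open import Data.List.Relation.Unary.Any using (here; there; any?)
open import Data.Nat as ℕ using (ℕ; suc; s≤s; _≤_)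
import Data.Nat.Properties as ℕ
open import Data.Nat.Tactic.RingSolver using (solve-∀)
open import Data.Product using (Σ-syntax; ∃₂; ∃-syntax; _×_; _,_; proj₁; proj₂)
open import Data.Product.Relation.Binary.Pointwise.NonDependent using (×-poset)
open import Data.Sum as Sum using (_⊎_; inj₁; inj₂)
open import Function using (_∘_)
open import Function.Bundles using (_⇔_; mk⇔)
open import Level using (0ℓ)
open import Relation.Binary.Bundles using (Poset)
open import Relation.Binary.Morphism.Structures using (IsOrderIsomorphism)
open import Relation.Binary.Definitions using (tri<; tri≈; tri>)
open import Relation.Binary.PropositionalEquality
  using (_≡_; _≢_; refl; sym; trans; cong; cong₂; subst; subst₂; module ≡-Reasoning)
open import Relation.Nullary using (¬_; Dec; does; yes; no; contradiction)
open import Relation.Nullary.Decidable using (dec-true; dec-false)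

private
  variable
    n : ℕ

-- Transpositions

transpose-left : (p q : Fin n) → PC.transpose p q p ≡ q
transpose-left p q rewrite dec-true (p Fin.≟ p) refl = refl

transpose-right : (p q : Fin n) → PC.transpose p q q ≡ p
transpose-right p q with q Fin.≟ p
... | yes q≡p = q≡p
... | no _ rewrite dec-true (q Fin.≟ q) refl = refl

transpose-fix : {p q x : Fin n} → x ≢ p → x ≢ q → PC.transpose p q x ≡ x
transpose-fix {p = p} {q} {x} x≢p x≢q
  rewrite dec-false (x Fin.≟ p) x≢p | dec-false (x Fin.≟ q) x≢q = refl

transpose-comm : (p q x : Fin n) → PC.transpose p q x ≡ PC.transpose q p x
transpose-comm p q x = helper (x Fin.≟ p) (x Fin.≟ q)
  where
  helper : Dec (x ≡ p) → Dec (x ≡ q) → PC.transpose p q x ≡ PC.transpose q p x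
  helper (yes refl) _ = trans (transpose-left x q) (sym (transpose-right q x))
  helper (no _) (yes refl) = trans (transpose-right p x) (sym (transpose-left x p))
  helper (no x≢p) (no x≢q) = trans (transpose-fix x≢p x≢q) (sym (transpose-fix x≢q x≢p))

transpose-involutive : (p q x : Fin n) → PC.transpose p q (PC.transpose p q x) ≡ x
transpose-involutive p q x =
  trans (cong (PC.transpose p q) (transpose-comm p q x)) (PC.transpose-inverse p q)

⟨$⟩ʳ-injective : (π : Permutation′ n) {x y : Fin n} → π ⟨$⟩ʳ x ≡ π ⟨$⟩ʳ y → x ≡ y
⟨$⟩ʳ-injective π eq = trans (sym (inverseˡ π)) (trans (cong (π ⟨$⟩ˡ_) eq) (inverseˡ π))

⟨$⟩ˡ-cong : (π ρ : Permutation′ n) → π Perm.≈ ρ → ∀ x → π ⟨$⟩ˡ x ≡ ρ ⟨$⟩ˡ x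
⟨$⟩ˡ-cong π ρ π≈ρ x =
  ⟨$⟩ʳ-injective π (trans (inverseʳ π) (trans (sym (inverseʳ ρ)) (sym (π≈ρ _))))

transpose-conjugate : (π : Permutation′ n) (p q x : Fin n) →
  π ⟨$⟩ʳ PC.transpose p q x ≡ PC.transpose (π ⟨$⟩ʳ p) (π ⟨$⟩ʳ q) (π ⟨$⟩ʳ x)
transpose-conjugate π p q x = helper (x Fin.≟ p) (x Fin.≟ q)
  where
  helper : Dec (x ≡ p) → Dec (x ≡ q) →
    π ⟨$⟩ʳ PC.transpose p q x ≡ PC.transpose (π ⟨$⟩ʳ p) (π ⟨$⟩ʳ q) (π ⟨$⟩ʳ x)
  helper (yes refl) _ =
    trans (cong (π ⟨$⟩ʳ_) (transpose-left x q)) (sym (transpose-left (π ⟨$⟩ʳ x) (π ⟨$⟩ʳ q)))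
  helper (no _) (yes refl) =
    trans (cong (π ⟨$⟩ʳ_) (transpose-right p x)) (sym (transpose-right (π ⟨$⟩ʳ p) (π ⟨$⟩ʳ x)))
  helper (no x≢p) (no x≢q) =
    trans (cong (π ⟨$⟩ʳ_) (transpose-fix x≢p x≢q))
      (sym (transpose-fix (x≢p ∘ ⟨$⟩ʳ-injective π) (x≢q ∘ ⟨$⟩ʳ-injective π)))

-- Simple transpositions

-- The two points that a letter swaps. Matching on n makes `pred n` reduce, so that `inject₁` and
-- `Fin.suc` have the right types.
lower upper : ∀ n → Letter n → Fin n
lower (suc _) = inject₁
upper (suc _) = Fin.suc

toℕ-lower : ∀ n (k : Letter n) → toℕ (lower n k) ≡ toℕ k
toℕ-lower (suc _) = Fin.toℕ-inject₁

toℕ-upper : ∀ n (k : Letter n) → toℕ (upper n k) ≡ suc (toℕ k)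
toℕ-upper (suc _) k = refl

σʳ≡transpose : ∀ n (k : Letter n) (x : Fin n) →
  σ k ⟨$⟩ʳ x ≡ PC.transpose (lower n k) (upper n k) x
σʳ≡transpose (suc _) k x = refl

σˡ≡transpose : ∀ n (k : Letter n) (x : Fin n) →
  σ k ⟨$⟩ˡ x ≡ PC.transpose (upper n k) (lower n k) x
σˡ≡transpose (suc _) k x = refl

upper-onto : ∀ n (q : Fin n) {m} → toℕ q ≡ suc m →
  ∃[ k ] (upper n k ≡ q × toℕ (lower n k) ≡ m)
upper-onto (suc n) (Fin.suc k) refl = k , refl , Fin.toℕ-inject₁ k

module _ {n : ℕ} where

  open import Data.List.Membership.DecPropositional (Fin._≟_ {ℕ.pred n}) using (_∈?_)

  infix 4 _≈_

  _≈_ : Permutation′ n → Permutation′ n → Set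
  _≈_ = Perm._≈_

  lo hi : Letter n → Fin n
  lo = lower n
  hi = upper n

  toℕ-lo : (k : Letter n) → toℕ (lo k) ≡ toℕ k
  toℕ-lo = toℕ-lower n

  toℕ-hi : (k : Letter n) → toℕ (hi k) ≡ suc (toℕ k)
  toℕ-hi = toℕ-upper n

  σ-transpose : (k : Letter n) (x : Fin n) → σ k ⟨$⟩ʳ x ≡ PC.transpose (lo k) (hi k) x
  σ-transpose = σʳ≡transpose n

  σˡ≡σʳ : (k : Letter n) (x : Fin n) → σ k ⟨$⟩ˡ x ≡ σ k ⟨$⟩ʳ x
  σˡ≡σʳ k x = trans (σˡ≡transpose n k x)
    (trans (transpose-comm (hi k) (lo k) x) (sym (σ-transpose k x)))

  σ-lo : (k : Letter n) → σ k ⟨$⟩ʳ lo k ≡ hi k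
  σ-lo k = trans (σ-transpose k _) (transpose-left (lo k) (hi k))

  σ-hi : (k : Letter n) → σ k ⟨$⟩ʳ hi k ≡ lo k
  σ-hi k = trans (σ-transpose k _) (transpose-right (lo k) (hi k))

  σ-fix : (k : Letter n) {x : Fin n} → x ≢ lo k → x ≢ hi k → σ k ⟨$⟩ʳ x ≡ x
  σ-fix k x≢lo x≢hi = trans (σ-transpose k _) (transpose-fix x≢lo x≢hi)

  σ-involutive : (k : Letter n) (x : Fin n) → σ k ⟨$⟩ʳ (σ k ⟨$⟩ʳ x) ≡ x
  σ-involutive k x = trans (cong (σ k ⟨$⟩ʳ_) (sym (σˡ≡σʳ k x))) (inverseʳ (σ k))

  lo<hi : (k : Letter n) → lo k < hi k
  lo<hi k rewrite toℕ-lo k | toℕ-hi k = ℕ.≤-refl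

  lo<⇒hi< : (k : Letter n) {x : Fin n} → x ≢ hi k → lo k < x → hi k < x
  lo<⇒hi< k {x} x≢hi lo<x = Fin.≤∧≢⇒< hi≤x (x≢hi ∘ sym)
    where
    hi≤x : toℕ (hi k) ≤ toℕ x
    hi≤x rewrite toℕ-hi k | toℕ-lo k = lo<x

  <hi⇒<lo : (k : Letter n) {x : Fin n} → x ≢ lo k → x < hi k → x < lo k
  <hi⇒<lo k {x} x≢lo x<hi = Fin.≤∧≢⇒< x≤lo x≢lo
    where
    x≤lo : toℕ x ≤ toℕ (lo k)
    x≤lo rewrite toℕ-hi k | toℕ-lo k = ℕ.≤-pred x<hi

  -- No point lies strictly between `lo k` and `hi k`, so swapping them can reverse the order of
  -- that pair only.
  σ-mono-< : (k : Letter n) {p q : Fin n} → p < q →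
    (p ≡ lo k × q ≡ hi k) ⊎ (σ k ⟨$⟩ʳ p < σ k ⟨$⟩ʳ q)
  σ-mono-< k {p} {q} p<q = helper (p Fin.≟ lo k) (p Fin.≟ hi k) (q Fin.≟ lo k) (q Fin.≟ hi k)
    where
    move : ∀ {p′ q′} → σ k ⟨$⟩ʳ p ≡ p′ → σ k ⟨$⟩ʳ q ≡ q′ → p′ < q′ →
      (p ≡ lo k × q ≡ hi k) ⊎ (σ k ⟨$⟩ʳ p < σ k ⟨$⟩ʳ q)
    move refl refl lt = inj₂ lt
    helper : Dec (p ≡ lo k) → Dec (p ≡ hi k) → Dec (q ≡ lo k) → Dec (q ≡ hi k) →
      (p ≡ lo k × q ≡ hi k) ⊎ (σ k ⟨$⟩ʳ p < σ k ⟨$⟩ʳ q)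
    helper (yes p≡lo) _ _ (yes q≡hi) = inj₁ (p≡lo , q≡hi)
    helper (yes refl) _ (yes refl) (no _) = contradiction p<q (Fin.<-irrefl refl)
    helper (yes refl) _ (no q≢lo) (no q≢hi) =
      move (σ-lo k) (σ-fix k q≢lo q≢hi) (lo<⇒hi< k q≢hi p<q)
    helper (no _) (yes refl) (yes refl) _ = contradiction p<q (Fin.<-asym (lo<hi k))
    helper (no _) (yes refl) (no _) (yes refl) = contradiction p<q (Fin.<-irrefl refl)
    helper (no _) (yes refl) (no q≢lo) (no q≢hi) =
      move (σ-hi k) (σ-fix k q≢lo q≢hi) (Fin.<-trans (lo<hi k) p<q)
    helper (no p≢lo) (no p≢hi) (yes refl) _ =
      move (σ-fix k p≢lo p≢hi) (σ-lo k) (Fin.<-trans p<q (lo<hi k))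
    helper (no p≢lo) (no p≢hi) (no _) (yes refl) =
      move (σ-fix k p≢lo p≢hi) (σ-hi k) (<hi⇒<lo k p≢lo p<q)
    helper (no p≢lo) (no p≢hi) (no q≢lo) (no q≢hi) =
      move (σ-fix k p≢lo p≢hi) (σ-fix k q≢lo q≢hi) p<q

  ⟦⟧-++ : (s t : Word n) (x : Fin n) → ⟦ s ++ t ⟧ ⟨$⟩ʳ x ≡ ⟦ s ⟧ ⟨$⟩ʳ (⟦ t ⟧ ⟨$⟩ʳ x)
  ⟦⟧-++ [] t x = refl
  ⟦⟧-++ (k ∷ s) t x = cong (σ k ⟨$⟩ʳ_) (⟦⟧-++ s t x)

  -- Reduced words

  Shortens : Word n → Word n → Set
  Shortens r t = r ⊆ t × length t ≡ suc (length r)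

  -- Stripping letters from the front carries the pair p < q along by conjugation. Since `t` inverts
  -- the pair, at some letter k it becomes (`lo k`, `hi k`), and deleting that letter has the effect
  -- of the transposition.
  strong-exchange : (t : Word n) {p q : Fin n} → p < q → ⟦ t ⟧ ⟨$⟩ˡ q < ⟦ t ⟧ ⟨$⟩ˡ p →
    ∃[ r ] (Shortens r t × ⟦ t ⟧ ∘ₚ transpose p q ≈ ⟦ r ⟧)
  strong-exchange [] p<q q<p = contradiction q<p (Fin.<-asym p<q)
  strong-exchange (k ∷ t) {p} {q} p<q inv with σ-mono-< k p<q
  ... | inj₁ (refl , refl) = t , (k ∷ʳ ⊆-refl , refl) ,
    λ x → trans (sym (σ-transpose k _)) (σ-involutive k _)
  ... | inj₂ σp<σq
    with r , (r⊆t , len) , eq ←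
      strong-exchange t σp<σq
        (subst₂ (λ a b → ⟦ t ⟧ ⟨$⟩ˡ a < ⟦ t ⟧ ⟨$⟩ˡ b) (σˡ≡σʳ k q) (σˡ≡σʳ k p) inv)
    = k ∷ r , (refl ∷ r⊆t , cong suc len) , λ x → begin
      PC.transpose p q (σ k ⟨$⟩ʳ (⟦ t ⟧ ⟨$⟩ʳ x))
        ≡⟨ cong₂ (λ a b → PC.transpose a b (σ k ⟨$⟩ʳ (⟦ t ⟧ ⟨$⟩ʳ x)))
            (sym (σ-involutive k p)) (sym (σ-involutive k q)) ⟩
      PC.transpose (σ k ⟨$⟩ʳ (σ k ⟨$⟩ʳ p)) (σ k ⟨$⟩ʳ (σ k ⟨$⟩ʳ q)) (σ k ⟨$⟩ʳ (⟦ t ⟧ ⟨$⟩ʳ x))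
        ≡⟨ sym (transpose-conjugate (σ k) _ _ _) ⟩
      σ k ⟨$⟩ʳ PC.transpose (σ k ⟨$⟩ʳ p) (σ k ⟨$⟩ʳ q) (⟦ t ⟧ ⟨$⟩ʳ x)
        ≡⟨ cong (σ k ⟨$⟩ʳ_) (eq x) ⟩
      σ k ⟨$⟩ʳ (⟦ r ⟧ ⟨$⟩ʳ x) ∎
    where open ≡-Reasoning

  -- Left ascents and descents: `u ∘ₚ σ k` multiplies by σ k on the left, which swaps the values
  -- `lo k` and `hi k`, so their positions are compared.
  Ascent Descent : Letter n → Permutation′ n → Set
  Ascent k u = u ⟨$⟩ˡ lo k < u ⟨$⟩ˡ hi k
  Descent k u = u ⟨$⟩ˡ hi k < u ⟨$⟩ˡ lo k

  ascent⊎descent : (k : Letter n) (u : Permutation′ n) → Ascent k u ⊎ Descent k u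
  ascent⊎descent k u with Fin.<-cmp (u ⟨$⟩ˡ lo k) (u ⟨$⟩ˡ hi k)
  ... | tri< a _ _ = inj₁ a
  ... | tri> _ _ d = inj₂ d
  ... | tri≈ _ eq _ = contradiction
    (trans (sym (inverseʳ u)) (trans (cong (u ⟨$⟩ʳ_) eq) (inverseʳ u)))
    (Fin.<⇒≢ (lo<hi k))

  σˡ-lo : (k : Letter n) → σ k ⟨$⟩ˡ lo k ≡ hi k
  σˡ-lo k = trans (σˡ≡σʳ k _) (σ-lo k)

  σˡ-hi : (k : Letter n) → σ k ⟨$⟩ˡ hi k ≡ lo k
  σˡ-hi k = trans (σˡ≡σʳ k _) (σ-hi k)

  ascent⇒descent : (k : Letter n) (u : Permutation′ n) → Ascent k u → Descent k (u ∘ₚ σ k)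
  ascent⇒descent k u = subst₂ (λ a b → u ⟨$⟩ˡ a < u ⟨$⟩ˡ b) (sym (σˡ-hi k)) (sym (σˡ-lo k))

  descent⇒ascent : (k : Letter n) (u : Permutation′ n) → Descent k u → Ascent k (u ∘ₚ σ k)
  descent⇒ascent k u = subst₂ (λ a b → u ⟨$⟩ˡ a < u ⟨$⟩ˡ b) (sym (σˡ-lo k)) (sym (σˡ-hi k))

  descent-resp : (k : Letter n) (u w : Permutation′ n) → u ≈ w → Descent k u → Descent k w
  descent-resp k u w u≈w = subst₂ _<_ (⟨$⟩ˡ-cong u w u≈w _) (⟨$⟩ˡ-cong u w u≈w _)

  exchange : (k : Letter n) (t : Word n) → Descent k ⟦ t ⟧ →
    ∃[ r ] (Shortens r t × ⟦ k ∷ t ⟧ ≈ ⟦ r ⟧)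
  exchange k t d with r , short , eq ← strong-exchange t (lo<hi k) d =
    r , short , λ x → trans (σ-transpose k _) (eq x)

  Reduced : Word n → Set
  Reduced t = ∀ r → ⟦ r ⟧ ≈ ⟦ t ⟧ → length t ≤ length r

  reduced-++ʳ : (s t : Word n) → Reduced (s ++ t) → Reduced t
  reduced-++ʳ [] t red = red
  reduced-++ʳ (k ∷ s) t red = reduced-++ʳ s t
    λ r eq → ℕ.≤-pred (red (k ∷ r) (λ x → cong (σ k ⟨$⟩ʳ_) (eq x)))

  reduced-++ˡ : (s t : Word n) → Reduced (s ++ t) → Reduced s
  reduced-++ˡ s t red r eq = ℕ.+-cancelʳ-≤ (length t) _ _
    (subst₂ _≤_ (length-++ s) (length-++ r)
      (red (r ++ t) λ x → trans (⟦⟧-++ r t x) (trans (eq _) (sym (⟦⟧-++ s t x)))))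

  -- At a descent the exchange property would rewrite `k ∷ t` as a word two letters shorter.
  reduced⇒ascent : (k : Letter n) (t : Word n) → Reduced (k ∷ t) → Ascent k ⟦ t ⟧
  reduced⇒ascent k t red with ascent⊎descent k ⟦ t ⟧
  ... | inj₁ a = a
  ... | inj₂ d with r , (_ , len) , eq ← exchange k t d = contradiction
    (subst (λ l → suc l ≤ length r) len (red r (sym ∘ eq))) (ℕ.<⇒≱ (ℕ.m≤n+m (suc (length r)) 1))

  -- Any word of the product has a descent at k, so exchange deletes one of its letters and leaves a
  -- word of `⟦ t ⟧`, which is at least as long as `t`.
  reduced-∷ : (k : Letter n) (t : Word n) → Reduced t → Ascent k ⟦ t ⟧ → Reduced (k ∷ t)
  reduced-∷ k t red a r eq
    with r′ , (_ , len) , eq′ ← exchange k r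
      (descent-resp k ⟦ k ∷ t ⟧ ⟦ r ⟧ (sym ∘ eq) (ascent⇒descent k ⟦ t ⟧ a))
    = subst (_ ≤_) (sym len) (s≤s (red r′ λ x →
        trans (sym (eq′ x)) (trans (cong (σ k ⟨$⟩ʳ_) (eq x)) (σ-involutive k _))))

  reduced-exchange : (k : Letter n) (t r : Word n) → Reduced t → length t ≡ suc (length r) →
    ⟦ k ∷ t ⟧ ≈ ⟦ r ⟧ → Reduced r
  reduced-exchange k t r red len eq s s≈r = ℕ.≤-pred (subst (_≤ _) len
    (red (k ∷ s) λ x →
      trans (cong (σ k ⟨$⟩ʳ_) (trans (s≈r x) (sym (eq x)))) (σ-involutive k _)))

  -- The deletion property. Once the tail is reduced, k is kept at an ascent, and at a descent it
  -- cancels against the letter that exchange deletes.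
  reduce : (t : Word n) → ∃[ r ] (r ⊆ t × ⟦ r ⟧ ≈ ⟦ t ⟧ × Reduced r)
  reduce [] = [] , [] , (λ _ → refl) , λ _ _ → ℕ.z≤n
  reduce (k ∷ t) with reduce t
  ... | r , r⊆t , r≈t , red with ascent⊎descent k ⟦ r ⟧
  ...   | inj₁ a = k ∷ r , refl ∷ r⊆t , (λ x → cong (σ k ⟨$⟩ʳ_) (r≈t x)) , reduced-∷ k r red a
  ...   | inj₂ d with r′ , (r′⊆r , len) , eq ← exchange k r d =
    r′ , k ∷ʳ ⊆-trans r′⊆r r⊆t ,
    (λ x → trans (sym (eq x)) (cong (σ k ⟨$⟩ʳ_) (r≈t x))) , reduced-exchange k r r′ red len eq

  -- The Bruhat order

  infix 4 _≼_

  -- The description of ⪯ by reflections that create an inversion, which is evidently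
  -- transitive and does not depend on a choice of reduced words.
  data _≼_ : Permutation′ n → Permutation′ n → Set where
    equal : ∀ {u w} → u ≈ w → u ≼ w
    step  : ∀ {u w p q} → p < q → u ⟨$⟩ˡ p < u ⟨$⟩ˡ q → u ∘ₚ transpose p q ≼ w → u ≼ w

  ≼-respˡ : {u u′ w : Permutation′ n} → u ≈ u′ → u ≼ w → u′ ≼ w
  ≼-respˡ eq (equal u≈w) = equal λ x → trans (sym (eq x)) (u≈w x)
  ≼-respˡ {u = u} {u′} eq (step {p = p} {q} p<q a h) =
    step p<q (subst₂ _<_ (⟨$⟩ˡ-cong u u′ eq p) (⟨$⟩ˡ-cong u u′ eq q) a)
      (≼-respˡ (λ x → cong (PC.transpose p q) (eq x)) h)

  ≼-trans : {u v w : Permutation′ n} → u ≼ v → v ≼ w → u ≼ w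
  ≼-trans (equal u≈v) h = ≼-respˡ (sym ∘ u≈v) h
  ≼-trans (step p<q a g) h = step p<q a (≼-trans g h)

  ≼-ascent : (k : Letter n) (u : Permutation′ n) → Ascent k u → u ≼ u ∘ₚ σ k
  ≼-ascent k u a = step (lo<hi k) a (equal λ x → sym (σ-transpose k _))

  -- The lifting property. Multiplication by σ k conjugates the reflections of the chain and keeps
  -- their direction, unless a reflection is σ k itself; then that step of the chain is already the
  -- required move.
  ≼-lift : (k : Letter n) {u w : Permutation′ n} → u ≼ w → Descent k w → u ∘ₚ σ k ≼ w
  ≼-lift k {u} {w} (equal u≈w) d =
    ≼-trans (≼-ascent k (u ∘ₚ σ k) (descent⇒ascent k u (descent-resp k w u (sym ∘ u≈w) d)))
      (equal λ x → trans (σ-involutive k _) (u≈w x))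
  ≼-lift k {u} (step {p = p} {q} p<q a h) d with ≼-lift k h d | σ-mono-< k p<q
  ... | _ | inj₁ (refl , refl) = ≼-respˡ (λ x → sym (σ-transpose k _)) h
  ... | h′ | inj₂ σp<σq = step σp<σq
    (subst₂ (λ a b → u ⟨$⟩ˡ a < u ⟨$⟩ˡ b) (unσ p) (unσ q) a)
    (≼-respˡ (λ x → transpose-conjugate (σ k) p q _) h′)
    where
    unσ : ∀ x → x ≡ σ k ⟨$⟩ˡ (σ k ⟨$⟩ʳ x)
    unσ x = sym (inverseˡ (σ k))

  -- A skipped letter is an ascent from the tail. A kept letter is first skipped and then restored
  -- by the lifting property, since a reduced word has a descent at its first letter.
  ⊆⇒≼ : {s t : Word n} → Reduced t → s ⊆ t → ⟦ s ⟧ ≼ ⟦ t ⟧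
  ⊆⇒≼ red [] = equal λ _ → refl
  ⊆⇒≼ {t = k ∷ t} red (_ ∷ʳ s⊆t) =
    ≼-trans (⊆⇒≼ (reduced-++ʳ (k ∷ []) t red) s⊆t) (≼-ascent k ⟦ t ⟧ (reduced⇒ascent k t red))
  ⊆⇒≼ {t = k ∷ t} red (refl ∷ s⊆t) =
    ≼-lift k (⊆⇒≼ red (k ∷ʳ s⊆t)) (ascent⇒descent k ⟦ t ⟧ (reduced⇒ascent k t red))

  -- Going back down the chain, each reflection deletes one letter of the current word by strong
  -- exchange. The word found may be non-reduced.
  ≼⇒⊆ : {u w : Permutation′ n} → u ≼ w → (t : Word n) → ⟦ t ⟧ ≈ w →
    ∃[ s ] (s ⊆ t × ⟦ s ⟧ ≈ u)
  ≼⇒⊆ (equal u≈w) t t≈w = t , ⊆-refl , λ x → trans (t≈w x) (sym (u≈w x))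
  ≼⇒⊆ {u = u} (step {p = p} {q} p<q a h) t t≈w = delete (≼⇒⊆ h t t≈w)
    where
    preimage : ∀ s → ⟦ s ⟧ ≈ u ∘ₚ transpose p q → ∀ {y z} → PC.transpose q p z ≡ y →
      u ⟨$⟩ˡ y ≡ ⟦ s ⟧ ⟨$⟩ˡ z
    preimage s s≈uτ eq = trans (cong (u ⟨$⟩ˡ_) (sym eq))
      (sym (⟨$⟩ˡ-cong ⟦ s ⟧ (u ∘ₚ transpose p q) s≈uτ _))

    delete : ∃[ s ] (s ⊆ t × ⟦ s ⟧ ≈ u ∘ₚ transpose p q) → ∃[ s ] (s ⊆ t × ⟦ s ⟧ ≈ u)
    delete (s , s⊆t , s≈uτ)
      with r , (r⊆s , _) , eq ← strong-exchange s p<q (subst₂ _<_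
        (preimage s s≈uτ (transpose-left q p)) (preimage s s≈uτ (transpose-right q p)) a)
      = r , ⊆-trans r⊆s s⊆t , λ x → trans (sym (eq x))
          (trans (cong (PC.transpose p q) (s≈uτ x)) (transpose-involutive p q _))

  ⊆-length-≡ : {s t : Word n} → s ⊆ t → length t ≤ length s → s ≡ t
  ⊆-length-≡ s⊆t t≤s =
    Pointwise-≡⇒≡ (toPointwise (ℕ.≤-antisym (length-mono-≤ s⊆t) t≤s) s⊆t)

  -- The two inequalities give subwords r ⊆ s ⊆ t with r and t equal as permutations; the minimal
  -- length of `t` forces s = t.
  ≼-antisym-reduced : {u : Permutation′ n} (t : Word n) → Reduced t →
    u ≼ ⟦ t ⟧ → ⟦ t ⟧ ≼ u → u ≈ ⟦ t ⟧
  ≼-antisym-reduced t red u≼t t≼u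
    with s , s⊆t , s≈u ← ≼⇒⊆ u≼t t (λ _ → refl)
    with r , r⊆s , r≈t ← ≼⇒⊆ t≼u s s≈u
    with refl ← ⊆-length-≡ s⊆t (ℕ.≤-trans (red r r≈t) (length-mono-≤ r⊆s))
    = sym ∘ s≈u

  -- Recursion on d = q - p - 1: with k the letter for which `hi k` is q, conjugating the
  -- transposition of p and `lo k` by σ k gives that of p and q.
  transpose-word : ∀ d {p q : Fin n} → toℕ q ≡ suc (d ℕ.+ toℕ p) →
    ∃[ t ] ⟦ t ⟧ ≈ transpose p q
  transpose-word d {p} {q} q≡ with upper-onto n q q≡
  transpose-word ℕ.zero {p} q≡ | k , refl , lo≡ with refl ← Fin.toℕ-injective {i = lo k} {p} lo≡ =
    k ∷ [] , σ-transpose k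
  transpose-word (suc d) {p} q≡ | k , refl , lo≡ with t , t≈ ← transpose-word d {p} {lo k} lo≡ =
    k ∷ t ++ k ∷ [] , λ x → begin
      σ k ⟨$⟩ʳ (⟦ t ++ k ∷ [] ⟧ ⟨$⟩ʳ x)
        ≡⟨ cong (σ k ⟨$⟩ʳ_) (trans (⟦⟧-++ t (k ∷ []) x) (t≈ _)) ⟩
      σ k ⟨$⟩ʳ PC.transpose p (lo k) (σ k ⟨$⟩ʳ x)
        ≡⟨ transpose-conjugate (σ k) p (lo k) _ ⟩
      PC.transpose (σ k ⟨$⟩ʳ p) (σ k ⟨$⟩ʳ lo k) (σ k ⟨$⟩ʳ (σ k ⟨$⟩ʳ x))
        ≡⟨ cong (PC.transpose (σ k ⟨$⟩ʳ p) (σ k ⟨$⟩ʳ lo k)) (σ-involutive k x) ⟩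
      PC.transpose (σ k ⟨$⟩ʳ p) (σ k ⟨$⟩ʳ lo k) x
        ≡⟨ cong₂ (λ a b → PC.transpose a b x)
            (σ-fix k (Fin.<⇒≢ p<lo) (Fin.<⇒≢ (Fin.<-trans p<lo (lo<hi k)))) (σ-lo k) ⟩
      PC.transpose p (hi k) x ∎
    where
    open ≡-Reasoning
    p<lo : p < lo k
    p<lo = subst (suc (toℕ p) ≤_) (sym lo≡) (s≤s (ℕ.m≤n+m _ d))

  transposition-word : (p q : Fin n) → ∃[ t ] ⟦ t ⟧ ≈ transpose p q
  transposition-word p q with Fin.<-cmp p q
  ... | tri< p<q _ _ = transpose-word (toℕ q ℕ.∸ suc (toℕ p))
    (sym (trans (sym (ℕ.+-suc _ _)) (ℕ.m∸n+n≡m p<q)))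
  ... | tri≈ _ refl _ = [] , λ x → helper x (x Fin.≟ p)
    where
    helper : ∀ x → Dec (x ≡ p) → x ≡ PC.transpose p p x
    helper x (yes refl) = sym (transpose-left x x)
    helper x (no x≢p) = sym (transpose-fix x≢p x≢p)
  ... | tri> _ _ q<p
    with t , t≈ ← transpose-word (toℕ p ℕ.∸ suc (toℕ q)) {q} {p}
      (sym (trans (sym (ℕ.+-suc _ _)) (ℕ.m∸n+n≡m q<p)))
    = t , λ x → trans (t≈ x) (transpose-comm q p x)

  word-of-eval : (xs : TranspositionList n) → ∃[ t ] ⟦ t ⟧ ≈ eval xs
  word-of-eval [] = [] , λ _ → refl
  word-of-eval ((p , q) ∷ xs)
    with s , s≈ ← word-of-eval xs | t , t≈ ← transposition-word p q
    = s ++ t , λ x → trans (⟦⟧-++ s t x) (trans (s≈ _) (cong (eval xs ⟨$⟩ʳ_) (t≈ x)))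

  reduced-word : (w : Permutation′ n) → ∃[ t ] (⟦ t ⟧ ≈ w × Reduced t)
  reduced-word w
    with s , s≈ ← word-of-eval (decompose w)
    with t , _ , t≈s , red ← reduce s
    = t , (λ x → trans (t≈s x) (trans (s≈ x) (eval-decompose w x))) , red

  ≼-antisym : {u w : Permutation′ n} → u ≼ w → w ≼ u → u ≈ w
  ≼-antisym {u} {w} u≼w w≼u with t , t≈w , red ← reduced-word w = λ x →
    trans
      (≼-antisym-reduced {u} t red
        (≼-trans u≼w (equal (sym ∘ t≈w))) (≼-respˡ (sym ∘ t≈w) w≼u) x)
      (t≈w x)

  isReducedWord⇒Reduced : (t : Word n) (w : Permutation′ n) → IsReducedWord t w → Reduced t
  isReducedWord⇒Reduced t w (t≈w , minimal) r r≈t = minimal r λ x → trans (r≈t x) (t≈w x)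

  reduced⇒isReducedWord : (t : Word n) (w : Permutation′ n) → ⟦ t ⟧ ≈ w → Reduced t →
    IsReducedWord t w
  reduced⇒isReducedWord t w t≈w red = t≈w , λ r r≈w → red r λ x → trans (r≈w x) (sym (t≈w x))

  ⪯⇒≼ : {u w : Permutation′ n} → u ⪯ w → u ≼ w
  ⪯⇒≼ {u} {w} (s , t , (s≈u , _) , rt@(t≈w , _) , s⊆t) =
    ≼-respˡ s≈u (≼-trans (⊆⇒≼ (isReducedWord⇒Reduced t w rt) s⊆t) (equal t≈w))

  -- A reduced word of w contains some word of u, and `reduce` only passes to a smaller subword.
  ≼⇒⪯ : {u w : Permutation′ n} → u ≼ w → u ⪯ w
  ≼⇒⪯ {u} {w} u≼w
    with t , t≈w , redₜ ← reduced-word w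
    with s , s⊆t , s≈u ← ≼⇒⊆ u≼w t t≈w
    with r , r⊆s , r≈s , redᵣ ← reduce s
    = r , t , reduced⇒isReducedWord r u (λ x → trans (r≈s x) (s≈u x)) redᵣ ,
      reduced⇒isReducedWord t w t≈w redₜ , ⊆-trans r⊆s s⊆t

  id≼ : (u : Permutation′ n) → ⟦ [] ⟧ ≼ u
  id≼ u with t , t≈u , red ← reduced-word u =
    ≼-trans (⊆⇒≼ red (minimum t)) (equal t≈u)

  -- If the first letter is skipped, the tail serves. If it is kept, take z for the tails: at an
  -- ascent `k ∷ z` is reduced and serves; at a descent `k ∷ s` lies below z by lifting, hence below
  -- the tail, which serves again.
  subword-coatom : {s t : Word n} → Reduced t → s ⊆ t → ¬ (⟦ s ⟧ ≈ ⟦ t ⟧) →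
    ∃[ z ] (Shortens z t × Reduced z × ⟦ s ⟧ ≼ ⟦ z ⟧)
  subword-coatom red [] s≉t = contradiction (λ _ → refl) s≉t
  subword-coatom {t = k ∷ t} red (_ ∷ʳ s⊆t) _ =
    t , (k ∷ʳ ⊆-refl , refl) , redₜ , ⊆⇒≼ redₜ s⊆t
    where redₜ = reduced-++ʳ (k ∷ []) t red
  subword-coatom {k ∷ s} {k ∷ t} red (refl ∷ s⊆t) ks≉kt
    with reduced-++ʳ (k ∷ []) t red
  ... | redₜ with subword-coatom redₜ s⊆t (λ s≈t → ks≉kt λ x → cong (σ k ⟨$⟩ʳ_) (s≈t x))
  ...   | z , (z⊆t , len) , red-z , s≼z with ascent⊎descent k ⟦ z ⟧
  ...     | inj₁ a = k ∷ z , (refl ∷ z⊆t , cong suc len) , reduced-∷ k z red-z a ,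
    ≼-lift k (≼-trans s≼z (≼-ascent k ⟦ z ⟧ a)) (ascent⇒descent k ⟦ z ⟧ a)
  ...     | inj₂ d = t , (k ∷ʳ ⊆-refl , refl) , redₜ , ≼-trans (≼-lift k s≼z d) (⊆⇒≼ redₜ z⊆t)

  coatom : {u : Permutation′ n} (t : Word n) → Reduced t → u ≼ ⟦ t ⟧ → ¬ (u ≈ ⟦ t ⟧) →
    ∃[ z ] (Shortens z t × Reduced z × u ≼ ⟦ z ⟧)
  coatom t red u≼t u≉t
    with s , s⊆t , s≈u ← ≼⇒⊆ u≼t t (λ _ → refl)
    with z , short , red-z , s≼z ← subword-coatom red s⊆t
      (λ s≈t → u≉t λ x → trans (sym (s≈u x)) (s≈t x))
    = z , short , red-z , ≼-respˡ s≈u s≼z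

  -- Support

  -- A cut of the points between `lo i` and `hi i`. Only σ i moves points across it, so it detects
  -- whether i occurs in a word.
  below : Letter n → Fin n → Bool
  below i x = does (toℕ x ℕ.≤? toℕ i)

  below-lo : (i : Letter n) → below i (lo i) ≡ true
  below-lo i = dec-true (_ ℕ.≤? _) (ℕ.≤-reflexive (toℕ-lo i))

  below-hi : (i : Letter n) → below i (hi i) ≡ false
  below-hi i = dec-false (_ ℕ.≤? _) (ℕ.<⇒≱ (ℕ.≤-reflexive (sym (toℕ-hi i))))

  below-lo≡hi : (i k : Letter n) → k ≢ i → below i (lo k) ≡ below i (hi k)
  below-lo≡hi i k k≢i rewrite toℕ-lo k | toℕ-hi k = helper (toℕ k ℕ.≤? toℕ i)
    where
    helper : Dec (toℕ k ≤ toℕ i) → does (toℕ k ℕ.≤? toℕ i) ≡ does (suc (toℕ k) ℕ.≤? toℕ i)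
    helper (yes k≤i) = trans (dec-true (_ ℕ.≤? _) k≤i)
      (sym (dec-true (_ ℕ.≤? _) (ℕ.≤∧≢⇒< k≤i (k≢i ∘ Fin.toℕ-injective))))
    helper (no k≰i) = trans (dec-false (_ ℕ.≤? _) k≰i)
      (sym (dec-false (_ ℕ.≤? _) (k≰i ∘ ℕ.<⇒≤)))

  σ-below : (i k : Letter n) (x : Fin n) → k ≢ i → below i (σ k ⟨$⟩ʳ x) ≡ below i x
  σ-below i k x k≢i = helper (x Fin.≟ lo k) (x Fin.≟ hi k)
    where
    helper : Dec (x ≡ lo k) → Dec (x ≡ hi k) → below i (σ k ⟨$⟩ʳ x) ≡ below i x
    helper (yes refl) _ = trans (cong (below i) (σ-lo k)) (sym (below-lo≡hi i k k≢i))
    helper (no _) (yes refl) = trans (cong (below i) (σ-hi k)) (below-lo≡hi i k k≢i)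
    helper (no x≢lo) (no x≢hi) = cong (below i) (σ-fix k x≢lo x≢hi)

  ∉-below : (i : Letter n) (t : Word n) → i ∉ t → ∀ x → below i (⟦ t ⟧ ⟨$⟩ʳ x) ≡ below i x
  ∉-below i [] _ x = refl
  ∉-below i (k ∷ t) i∉ x = trans (σ-below i k _ (i∉ ∘ here ∘ sym)) (∉-below i t (i∉ ∘ there) x)

  -- The point that `q` carries to `lo i` is taken across the cut by the single i, whereas a word
  -- without i takes no point across.
  ∉-≉ : (i : Letter n) (p q s : Word n) → i ∉ p → i ∉ q → i ∉ s → ¬ (⟦ p ++ i ∷ q ⟧ ≈ ⟦ s ⟧)
  ∉-≉ i p q s i∉p i∉q i∉s eq = contradiction (trans (sym below-s) below-piq) λ ()
    where
    x : Fin n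
    x = ⟦ q ⟧ ⟨$⟩ˡ lo i
    below-s : below i (⟦ s ⟧ ⟨$⟩ʳ x) ≡ true
    below-s = begin
      below i (⟦ s ⟧ ⟨$⟩ʳ x) ≡⟨ ∉-below i s i∉s x ⟩
      below i x              ≡⟨ ∉-below i q i∉q x ⟨
      below i (⟦ q ⟧ ⟨$⟩ʳ x) ≡⟨ cong (below i) (inverseʳ ⟦ q ⟧) ⟩
      below i (lo i)         ≡⟨ below-lo i ⟩
      true                   ∎
      where open ≡-Reasoning
    below-piq : below i (⟦ s ⟧ ⟨$⟩ʳ x) ≡ false
    below-piq = begin
      below i (⟦ s ⟧ ⟨$⟩ʳ x)                         ≡⟨ cong (below i) (sym (eq x)) ⟩
      below i (⟦ p ++ i ∷ q ⟧ ⟨$⟩ʳ x)                ≡⟨ cong (below i) (⟦⟧-++ p (i ∷ q) x) ⟩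
      below i (⟦ p ⟧ ⟨$⟩ʳ (σ i ⟨$⟩ʳ (⟦ q ⟧ ⟨$⟩ʳ x))) ≡⟨ ∉-below i p i∉p _ ⟩
      below i (σ i ⟨$⟩ʳ (⟦ q ⟧ ⟨$⟩ʳ x))
        ≡⟨ cong (λ y → below i (σ i ⟨$⟩ʳ y)) (inverseʳ ⟦ q ⟧) ⟩
      below i (σ i ⟨$⟩ʳ lo i)                        ≡⟨ cong (below i) (σ-lo i) ⟩
      below i (hi i)                                 ≡⟨ below-hi i ⟩
      false                                          ∎
      where open ≡-Reasoning

  letter≼⇒∈ : (i : Letter n) (t : Word n) → ⟦ i ∷ [] ⟧ ≼ ⟦ t ⟧ → i ∈ t
  letter≼⇒∈ i t i≼t with i ∈? t
  ... | yes i∈t = i∈t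
  ... | no i∉t with s , s⊆t , s≈i ← ≼⇒⊆ i≼t t (λ _ → refl) =
    ⊥-elim (∉-≉ i [] [] s (λ ()) (λ ()) (i∉t ∘ Any-resp-⊆ s⊆t) (sym ∘ s≈i))

  ∈⇒letter≼ : (i : Letter n) (t : Word n) → Reduced t → i ∈ t → ⟦ i ∷ [] ⟧ ≼ ⟦ t ⟧
  ∈⇒letter≼ i t red i∈t = ⊆⇒≼ red (from∈ i∈t)

  -- Each of the two letters occurs exactly once, so by `∉-≉` it occurs in every word of the same
  -- permutation.
  reduced-pair : (i j : Letter n) → i ≢ j → Reduced (i ∷ j ∷ [])
  reduced-pair i j i≢j r r≈ij = two r i∈r j∈r
    where
    i∈r : i ∈ r
    i∈r with i ∈? r
    ... | yes i∈r = i∈r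
    ... | no i∉r = ⊥-elim
      (∉-≉ i [] (j ∷ []) r (λ ()) (λ { (here i≡j) → i≢j i≡j }) i∉r (sym ∘ r≈ij))
    j∈r : j ∈ r
    j∈r with j ∈? r
    ... | yes j∈r = j∈r
    ... | no j∉r = ⊥-elim
      (∉-≉ j (i ∷ []) [] r (λ { (here j≡i) → i≢j (sym j≡i) }) (λ ()) j∉r (sym ∘ r≈ij))
    two : ∀ s → i ∈ s → j ∈ s → 2 ≤ length s
    two (_ ∷ []) (here i≡k) (here j≡k) = ⊥-elim (i≢j (trans i≡k (sym j≡k)))
    two (_ ∷ _ ∷ _) _ _ = s≤s (s≤s ℕ.z≤n)

  -- The products differ at `lo i`: the first sends it to `hi i`, which is `lo j`, and the second to
  -- `hi j`.
  adjacent-≉ : (i j : Letter n) → toℕ j ≡ suc (toℕ i) → ¬ (⟦ i ∷ j ∷ [] ⟧ ≈ ⟦ j ∷ i ∷ [] ⟧)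
  adjacent-≉ i j j≡1+i eq = Fin.<⇒≢ (lo<hi j) (begin
    lo j                     ≡⟨ sym hi≡lo ⟩
    hi i                     ≡⟨ sym (σ-lo i) ⟩
    σ i ⟨$⟩ʳ lo i            ≡⟨ cong (σ i ⟨$⟩ʳ_) (sym (σ-fix j (Fin.<⇒≢ lo<lo) lo≢hi)) ⟩
    σ i ⟨$⟩ʳ (σ j ⟨$⟩ʳ lo i) ≡⟨ eq (lo i) ⟩
    σ j ⟨$⟩ʳ (σ i ⟨$⟩ʳ lo i) ≡⟨ cong (σ j ⟨$⟩ʳ_) (trans (σ-lo i) hi≡lo) ⟩
    σ j ⟨$⟩ʳ lo j            ≡⟨ σ-lo j ⟩
    hi j                     ∎)
    where
    open ≡-Reasoning
    hi≡lo : hi i ≡ lo j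
    hi≡lo = Fin.toℕ-injective (trans (toℕ-hi i) (trans (sym j≡1+i) (sym (toℕ-lo j))))
    lo<lo : lo i < lo j
    lo<lo = subst (lo i <_) hi≡lo (lo<hi i)
    lo≢hi : lo i ≢ hi j
    lo≢hi = Fin.<⇒≢ (Fin.<-trans lo<lo (lo<hi j))

  -- Deleted letters and pairs of letters

  delete-one : {z t : Word n} → Shortens z t → ∃₂ λ a b → ∃[ k ] (t ≡ a ++ k ∷ b × z ≡ a ++ b)
  delete-one {t = k ∷ t} (_ ∷ʳ z⊆t , len)
    with refl ← ⊆-length-≡ z⊆t (ℕ.≤-reflexive (ℕ.suc-injective len)) = [] , t , k , refl , refl
  delete-one {t = k ∷ t} (refl ∷ z⊆t , len)
    with a , b , l , refl , refl ← delete-one (z⊆t , ℕ.suc-injective len)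
    = k ∷ a , b , l , refl , refl

  ∈-middle : {i k : Letter n} (a b : Word n) → i ∈ a ++ k ∷ b → i ∉ a ++ b → i ≡ k
  ∈-middle [] b (here i≡k) _ = i≡k
  ∈-middle [] b (there i∈b) i∉b = contradiction i∈b i∉b
  ∈-middle (_ ∷ a) b (here eq) i∉ = contradiction (here eq) i∉
  ∈-middle (_ ∷ a) b (there i∈) i∉ = ∈-middle a b i∈ (i∉ ∘ there)

  -- The deleted letter is the only i of `t`. A letter j on both sides of it makes ij and ji
  -- subwords, so σᵢ and σⱼ commute by hypothesis, which neighbours do not.
  coatom⇒unconfined : {i : Letter n} {z t : Word n} → Shortens z t → i ∉ z → i ∈ t →
    (∀ j → i ≢ j → i ∷ j ∷ [] ⊆ t → j ∷ i ∷ [] ⊆ t → ⟦ i ∷ j ∷ [] ⟧ ≈ ⟦ j ∷ i ∷ [] ⟧) →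
    UnconfinedIn i t
  coatom⇒unconfined {i} short i∉z i∈t commute
    with a , b , k , refl , refl ← delete-one short
    with refl ← ∈-middle a b i∈t i∉z
    = a , b , refl , i∉z ∘ ∈-++⁺ˡ , i∉z ∘ ∈-++⁺ʳ a ,
      (λ j j≡1+i → adjacent-≉ i j j≡1+i ∘ ij≈ji j) ,
      (λ j 1+j≡i j∈ab → adjacent-≉ j i (sym 1+j≡i) (sym ∘ ij≈ji j j∈ab))
    where
    ij≈ji : ∀ j → j ∈ a × j ∈ b → ⟦ i ∷ j ∷ [] ⟧ ≈ ⟦ j ∷ i ∷ [] ⟧
    ij≈ji j (j∈a , j∈b) = commute j (λ { refl → i∉z (∈-++⁺ˡ j∈a) })
      (++⁺ (minimum a) (refl ∷ from∈ j∈b)) (++⁺ (from∈ j∈a) (refl ∷ minimum b))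

  ⊆-pair : {i j : Letter n} {s : Word n} → i ≢ j → s ⊆ i ∷ j ∷ [] → i ∈ s → j ∈ s →
    s ≡ i ∷ j ∷ []
  ⊆-pair i≢j (_ ∷ʳ _ ∷ʳ []) () _
  ⊆-pair i≢j (_ ∷ʳ refl ∷ []) (here i≡j) _ = contradiction i≡j i≢j
  ⊆-pair i≢j (refl ∷ _ ∷ʳ []) _ (here j≡i) = contradiction (sym j≡i) i≢j
  ⊆-pair i≢j (refl ∷ refl ∷ []) _ _ = refl

  -- A subword of `i ∷ j ∷ []` with both letters is the whole word. Thus σᵢσⱼ is a minimal upper
  -- bound of σᵢ and σⱼ, and equals their join if there is one below it.
  pair-unique : {i j : Letter n} {c : Permutation′ n} → i ≢ j →
    ⟦ i ∷ [] ⟧ ≼ c → ⟦ j ∷ [] ⟧ ≼ c → c ≼ ⟦ i ∷ j ∷ [] ⟧ → c ≈ ⟦ i ∷ j ∷ [] ⟧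
  pair-unique {i} {j} i≢j i≼c j≼c c≼ij
    with s , s⊆ij , s≈c ← ≼⇒⊆ c≼ij (i ∷ j ∷ []) (λ _ → refl)
    with refl ← ⊆-pair i≢j s⊆ij (letter≼⇒∈ i s (≼-trans i≼c (equal (sym ∘ s≈c))))
      (letter≼⇒∈ j s (≼-trans j≼c (equal (sym ∘ s≈c))))
    = sym ∘ s≈c

  -- From a prism to an unconfined letter

  module Prism (w : Permutation′ n) (prism : IsPrism w) where

    private
      X : Poset 0ℓ 0ℓ 0ℓ
      X = proj₁ prism
      module X = Poset X
      module 𝟐×X = Poset (×-poset Bool.≤-poset X)

      f : B w → Bool × X.Carrier
      f = proj₁ (proj₂ prism)

      open IsOrderIsomorphism (proj₂ (proj₂ prism)) using (mono; cancel; surjective)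

      record Element : Set where
        constructor element
        field
          perm : Permutation′ n
          perm≼w : perm ≼ w
      open Element

      F : Element → Bool × X.Carrier
      F (element u u≼w) = f (u , ≼⇒⪯ u≼w)

      F-mono : (u v : Element) → perm u ≼ perm v → F u 𝟐×X.≤ F v
      F-mono u v u≼v = mono (≼⇒⪯ u≼v)

      F-cancel : (u v : Element) → F u 𝟐×X.≤ F v → perm u ≼ perm v
      F-cancel u v Fu≤Fv = ⪯⇒≼ (cancel Fu≤Fv)

      F-surjective : ∀ y → ∃[ u ] F u 𝟐×X.≈ y
      F-surjective y with (u , u⪯w) , fu≈y ← surjective y =
        element u (⪯⇒≼ u⪯w) , fu≈y λ _ → refl

      -- A choice of preimages. The next four lemmas carry inequalities across it in both
      -- directions, so that the order of 𝟐 × X can be used inside B(w).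
      F⁻¹ : Bool × X.Carrier → Element
      F⁻¹ y = proj₁ (F-surjective y)

      F⁻¹-≤ : ∀ u y → y 𝟐×X.≤ F u → perm (F⁻¹ y) ≼ perm u
      F⁻¹-≤ u y y≤Fu = F-cancel (F⁻¹ y) u
        (𝟐×X.trans (𝟐×X.reflexive (proj₂ (F-surjective y))) y≤Fu)

      ≤-F⁻¹ : ∀ u y → F u 𝟐×X.≤ y → perm u ≼ perm (F⁻¹ y)
      ≤-F⁻¹ u y Fu≤y = F-cancel u (F⁻¹ y)
        (𝟐×X.trans Fu≤y (𝟐×X.reflexive (𝟐×X.Eq.sym (proj₂ (F-surjective y)))))

      F⁻¹-≤⁻ : ∀ u y → perm (F⁻¹ y) ≼ perm u → y 𝟐×X.≤ F u
      F⁻¹-≤⁻ u y h = 𝟐×X.trans (𝟐×X.reflexive (𝟐×X.Eq.sym (proj₂ (F-surjective y))))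
        (F-mono (F⁻¹ y) u h)

      ≤-F⁻¹⁻ : ∀ u y → perm u ≼ perm (F⁻¹ y) → F u 𝟐×X.≤ y
      ≤-F⁻¹⁻ u y h = 𝟐×X.trans (F-mono u (F⁻¹ y) h)
        (𝟐×X.reflexive (proj₂ (F-surjective y)))

      bottom top : Element
      bottom = element ⟦ [] ⟧ (id≼ w)
      top = element w (equal λ _ → refl)

      x₀ x₁ : X.Carrier
      x₀ = proj₂ (F bottom)
      x₁ = proj₂ (F top)

      bottom-≤ : ∀ y → F bottom 𝟐×X.≤ y
      bottom-≤ y = ≤-F⁻¹⁻ bottom y (id≼ _)

      ≤-top : ∀ y → y 𝟐×X.≤ F top
      ≤-top y = F⁻¹-≤⁻ top y (perm≼w (F⁻¹ y))

      ≤false : ∀ {b} → b Bool.≤ false → b ≡ false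
      ≤false Bool.b≤b = refl

      true≤ : ∀ {b} → true Bool.≤ b → b ≡ true
      true≤ Bool.b≤b = refl

      bottom-false : proj₁ (F bottom) ≡ false
      bottom-false = ≤false (proj₁ (bottom-≤ (false , x₀)))

      top-true : proj₁ (F top) ≡ true
      top-true = true≤ (proj₁ (≤-top (true , x₁)))

      x₀-min : ∀ x → x₀ X.≤ x
      x₀-min x = proj₂ (bottom-≤ (false , x))

      -- Only an inequality is asked for; `I-true` and `I-base` recover the position of the image in
      -- both coordinates.
      IsAtom : Letter n → Set
      IsAtom i = Σ[ i≼w ∈ ⟦ i ∷ [] ⟧ ≼ w ] F (element ⟦ i ∷ [] ⟧ i≼w) 𝟐×X.≤ (true , x₀)

      word-in : (t : Word n) → ⟦ t ⟧ ≈ w → Reduced t → {s : Word n} → s ⊆ t → ⟦ s ⟧ ≼ w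
      word-in t t≈w red s⊆t = ≼-trans (⊆⇒≼ red s⊆t) (equal t≈w)

      -- The first letter of a reduced word of `F⁻¹ (true , x₀)` lies below that element. The word
      -- is not empty, because the image of the identity has first coordinate `false`.
      atom : ∃[ i ] IsAtom i
      atom = first-letter (reduced-word (perm (F⁻¹ (true , x₀))))
        where
        first-letter : ∃[ t ] (⟦ t ⟧ ≈ perm (F⁻¹ (true , x₀)) × Reduced t) → ∃[ i ] IsAtom i
        first-letter ([] , []≈ , _) = contradiction
          (trans (sym bottom-false)
            (true≤ (proj₁ (F⁻¹-≤⁻ bottom (true , x₀) (equal (sym ∘ []≈))))))
          λ ()
        first-letter (i ∷ t , t≈ , red) =
          i , i≼w , ≤-F⁻¹⁻ (element ⟦ i ∷ [] ⟧ i≼w) (true , x₀) i≼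
          where
          i≼ : ⟦ i ∷ [] ⟧ ≼ perm (F⁻¹ (true , x₀))
          i≼ = ≼-trans (⊆⇒≼ red (refl ∷ minimum t)) (equal t≈)
          i≼w : ⟦ i ∷ [] ⟧ ≼ w
          i≼w = ≼-trans i≼ (perm≼w (F⁻¹ (true , x₀)))

      i : Letter n
      i = proj₁ atom

      i≼w : ⟦ i ∷ [] ⟧ ≼ w
      i≼w = proj₁ (proj₂ atom)

      I : Element
      I = element ⟦ i ∷ [] ⟧ i≼w

      I-base : proj₂ (F I) X.≤ x₀
      I-base = proj₂ (proj₂ (proj₂ atom))

      I-true : proj₁ (F I) ≡ true
      I-true = helper (proj₁ (F I)) refl
        where
        helper : ∀ b → proj₁ (F I) ≡ b → b ≡ true
        helper true _ = refl
        -- Otherwise `F I` would lie below `F bottom`, and i would occur in the empty word.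
        helper false eq = contradiction
          (letter≼⇒∈ i [] (F-cancel I bottom
            (subst (Bool._≤ proj₁ (F bottom)) (sym eq) (Bool.≤-minimum _) ,
              I-base)))
          λ ()

      I≤⇒true : (u : Element) → ⟦ i ∷ [] ⟧ ≼ perm u → proj₁ (F u) ≡ true
      I≤⇒true u i≼u = true≤ (subst (Bool._≤ proj₁ (F u)) I-true (proj₁ (F-mono I u i≼u)))

      v : Element
      v = F⁻¹ (false , x₁)

      v≉w : ¬ (perm v ≈ w)
      v≉w v≈w = contradiction
        (trans (sym top-true) (≤false (proj₁ (≤-F⁻¹⁻ top (false , x₁) (equal (sym ∘ v≈w))))))
        λ ()

      -- If i occurred in `z`, the image of `z` would have first coordinate `true` because of i and
      -- second coordinate at least `x₁` because of `v`. Then w would lie below `z`, which is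
      -- shorter than a reduced word of w.
      coatom-avoids : (t z : Word n) → ⟦ t ⟧ ≈ w → Reduced t → Shortens z t → Reduced z →
        perm v ≼ ⟦ z ⟧ → i ∉ z
      coatom-avoids t z t≈w red (z⊆t , len) red-z v≼z i∈z = too-short (≼⇒⊆ w≼z z (λ _ → refl))
        where
        Z : Element
        Z = element ⟦ z ⟧ (word-in t t≈w red z⊆t)
        w≼z : w ≼ ⟦ z ⟧
        w≼z = F-cancel top Z
          (subst (proj₁ (F top) Bool.≤_) (sym (I≤⇒true Z (∈⇒letter≼ i z red-z i∈z)))
            (Bool.≤-maximum _) ,
            proj₂ (F⁻¹-≤⁻ Z (false , x₁) v≼z))
        too-short : ¬ (∃[ s ] (s ⊆ z × ⟦ s ⟧ ≈ w))
        too-short (s , s⊆z , s≈w) =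
          ℕ.<⇒≱ (subst (length s ℕ.<_) (sym len) (s≤s (length-mono-≤ s⊆z)))
            (red s λ x → trans (s≈w x) (sym (t≈w x)))

      -- The atom σᵢ ↦ (true , x₀) and any other atom have a join in 𝟐 × X, hence in B(w), and
      -- pair-unique identifies it with both σᵢσⱼ and σⱼσᵢ.
      commuting : (j : Letter n) → i ≢ j → ⟦ i ∷ j ∷ [] ⟧ ≼ w → ⟦ j ∷ i ∷ [] ⟧ ≼ w →
        ⟦ i ∷ j ∷ [] ⟧ ≈ ⟦ j ∷ i ∷ [] ⟧
      commuting j i≢j ij≼w ji≼w x = trans
        (sym (pair-unique i≢j i≼c j≼c (c≼ (element ⟦ i ∷ j ∷ [] ⟧ ij≼w)
          (∈⇒letter≼ i (i ∷ j ∷ []) red-ij (here refl))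
          (∈⇒letter≼ j (i ∷ j ∷ []) red-ij (there (here refl)))) x))
        (pair-unique (i≢j ∘ sym) j≼c i≼c (c≼ (element ⟦ j ∷ i ∷ [] ⟧ ji≼w)
          (∈⇒letter≼ i (j ∷ i ∷ []) red-ji (there (here refl)))
          (∈⇒letter≼ j (j ∷ i ∷ []) red-ji (here refl))) x)
        where
        red-ij = reduced-pair i j i≢j
        red-ji = reduced-pair j i (i≢j ∘ sym)
        J : Element
        J = element ⟦ j ∷ [] ⟧ (≼-trans (∈⇒letter≼ j (i ∷ j ∷ []) red-ij (there (here refl))) ij≼w)
        c : Element
        c = F⁻¹ (true , proj₂ (F J))
        i≼c : ⟦ i ∷ [] ⟧ ≼ perm c
        i≼c = ≤-F⁻¹ I (true , proj₂ (F J)) (Bool.≤-maximum _ , X.trans I-base (x₀-min _))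
        j≼c : ⟦ j ∷ [] ⟧ ≼ perm c
        j≼c = ≤-F⁻¹ J (true , proj₂ (F J)) (Bool.≤-maximum _ , X.refl)
        c≼ : (u : Element) → ⟦ i ∷ [] ⟧ ≼ perm u → ⟦ j ∷ [] ⟧ ≼ perm u → perm c ≼ perm u
        c≼ u i≼u j≼u = F⁻¹-≤ u (true , proj₂ (F J))
          (subst (true Bool.≤_) (sym (I≤⇒true u i≼u)) Bool.b≤b , proj₂ (F-mono J u j≼u))

    unconfined-letter : ∃[ i ] ∃[ s ] (IsReducedWord s w × UnconfinedIn i s)
    unconfined-letter = from-word (reduced-word w)
      where
      from-word : ∃[ t ] (⟦ t ⟧ ≈ w × Reduced t) →
        ∃[ i ] ∃[ s ] (IsReducedWord s w × UnconfinedIn i s)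
      from-word (t , t≈w , red) =
        from-coatom (coatom t red (≼-trans (perm≼w v) (equal (sym ∘ t≈w)))
          (λ v≈t → v≉w λ x → trans (v≈t x) (t≈w x)))
        where
        from-coatom : ∃[ z ] (Shortens z t × Reduced z × perm v ≼ ⟦ z ⟧) →
          ∃[ i ] ∃[ s ] (IsReducedWord s w × UnconfinedIn i s)
        from-coatom (z , short , red-z , v≼z) =
          i , t , reduced⇒isReducedWord t w t≈w red ,
          coatom⇒unconfined short (coatom-avoids t z t≈w red short red-z v≼z)
            (letter≼⇒∈ i t (≼-trans i≼w (equal (sym ∘ t≈w))))
            λ j i≢j ij⊆t ji⊆t →
              commuting j i≢j (word-in t t≈w red ij⊆t) (word-in t t≈w red ji⊆t)

  -- Commuting letters and fixed points

  Commute : Letter n → Letter n → Set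
  Commute k j = ∀ (x : Fin n) → σ k ⟨$⟩ʳ (σ j ⟨$⟩ʳ x) ≡ σ j ⟨$⟩ʳ (σ k ⟨$⟩ʳ x)

  -- Conjugation by σ k leaves σ j unchanged, since the two points that σ j swaps lie above `hi k`
  -- and are fixed by σ k.
  commute-distant : (k j : Letter n) → suc (toℕ k) ℕ.< toℕ j → Commute k j
  commute-distant k j 1+k<j x = begin
    σ k ⟨$⟩ʳ (σ j ⟨$⟩ʳ x)
      ≡⟨ cong (σ k ⟨$⟩ʳ_) (σ-transpose j x) ⟩
    σ k ⟨$⟩ʳ PC.transpose (lo j) (hi j) x
      ≡⟨ transpose-conjugate (σ k) (lo j) (hi j) x ⟩
    PC.transpose (σ k ⟨$⟩ʳ lo j) (σ k ⟨$⟩ʳ hi j) (σ k ⟨$⟩ʳ x)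
      ≡⟨ cong₂ (λ a b → PC.transpose a b (σ k ⟨$⟩ʳ x))
          (fixed hi<lo) (fixed (Fin.<-trans hi<lo (lo<hi j))) ⟩
    PC.transpose (lo j) (hi j) (σ k ⟨$⟩ʳ x)
      ≡⟨ sym (σ-transpose j _) ⟩
    σ j ⟨$⟩ʳ (σ k ⟨$⟩ʳ x) ∎
    where
    open ≡-Reasoning
    hi<lo : hi k < lo j
    hi<lo = subst₂ ℕ._<_ (sym (toℕ-hi k)) (sym (toℕ-lo j)) 1+k<j
    fixed : ∀ {y} → hi k < y → σ k ⟨$⟩ʳ y ≡ y
    fixed hi<y = σ-fix k (Fin.<⇒≢ (Fin.<-trans (lo<hi k) hi<y) ∘ sym) (Fin.<⇒≢ hi<y ∘ sym)

  commute-word : (k : Letter n) {t : Word n} → All (Commute k) t →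
    ∀ (x : Fin n) → σ k ⟨$⟩ʳ (⟦ t ⟧ ⟨$⟩ʳ x) ≡ ⟦ t ⟧ ⟨$⟩ʳ (σ k ⟨$⟩ʳ x)
  commute-word k [] x = refl
  commute-word k {j ∷ t} (kj ∷ kt) x =
    trans (kj _) (cong (σ j ⟨$⟩ʳ_) (commute-word k kt x))

  commute-words : {s t : Word n} → All (λ k → All (Commute k) t) s →
    ∀ (x : Fin n) → ⟦ s ⟧ ⟨$⟩ʳ (⟦ t ⟧ ⟨$⟩ʳ x) ≡ ⟦ t ⟧ ⟨$⟩ʳ (⟦ s ⟧ ⟨$⟩ʳ x)
  commute-words [] x = refl
  commute-words {s = k ∷ s} (kt ∷ st) x =
    trans (cong (σ k ⟨$⟩ʳ_) (commute-words st x)) (commute-word k kt _)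

  word-fix : {s : Word n} {x : Fin n} → All (λ k → x ≢ lo k × x ≢ hi k) s → ⟦ s ⟧ ⟨$⟩ʳ x ≡ x
  word-fix [] = refl
  word-fix {s = k ∷ s} ((x≢lo , x≢hi) ∷ rest) =
    trans (cong (σ k ⟨$⟩ʳ_) (word-fix rest)) (σ-fix k x≢lo x≢hi)

  -- If `w` took the value `u ⟨$⟩ʳ x₀` at another point y, then `u`, which agrees with `w` at y,
  -- would take it at both y and x₀.
  ≈-except-one : (u w : Permutation′ n) (x₀ : Fin n) →
    (∀ x → x ≢ x₀ → u ⟨$⟩ʳ x ≡ w ⟨$⟩ʳ x) → u ≈ w
  ≈-except-one u w x₀ agree x with x Fin.≟ x₀
  ... | no x≢x₀ = agree x x≢x₀
  ... | yes refl with (w ⟨$⟩ˡ (u ⟨$⟩ʳ x)) Fin.≟ x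
  ...   | yes eq = trans (sym (inverseʳ w)) (cong (w ⟨$⟩ʳ_) eq)
  ...   | no y≢x = contradiction
    (⟨$⟩ʳ-injective u (trans (agree _ y≢x) (inverseʳ w))) y≢x

  ⊆-++⁻ : (xs : Word n) {ys s : Word n} → s ⊆ xs ++ ys →
    ∃₂ λ a b → s ≡ a ++ b × a ⊆ xs × b ⊆ ys
  ⊆-++⁻ [] s⊆ys = [] , _ , refl , [] , s⊆ys
  ⊆-++⁻ (x ∷ xs) (.x ∷ʳ s⊆) with a , b , refl , a⊆ , b⊆ ← ⊆-++⁻ xs s⊆ =
    a , b , refl , x ∷ʳ a⊆ , b⊆
  ⊆-++⁻ (x ∷ xs) (refl ∷ s⊆) with a , b , refl , a⊆ , b⊆ ← ⊆-++⁻ xs s⊆ =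
    x ∷ a , b , refl , refl ∷ a⊆ , b⊆

  bruhatPoset : Permutation′ n → Poset 0ℓ 0ℓ 0ℓ
  bruhatPoset v = record
    { Carrier = B v
    ; _≈_ = λ x y → proj₁ x ≈ proj₁ y
    ; _≤_ = λ x y → proj₁ x ⪯ proj₁ y
    ; isPartialOrder = record
      { isPreorder = record
        { isEquivalence = record
          { refl = λ _ → refl ; sym = λ eq → sym ∘ eq ; trans = λ eq eq′ x → trans (eq x) (eq′ x) }
        ; reflexive = λ {(u , _)} {(v , _)} eq → ≼⇒⪯ {u} {v} (equal eq)
        ; trans = λ {(u , _)} {(v , _)} {(w , _)} u⪯v v⪯w →
            ≼⇒⪯ {u} {w} (≼-trans (⪯⇒≼ {u} {v} u⪯v) (⪯⇒≼ {v} {w} v⪯w))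
        }
      ; antisym = λ {(u , _)} {(v , _)} u⪯v v⪯u →
          ≼-antisym {u} {v} (⪯⇒≼ {u} {v} u⪯v) (⪯⇒≼ {v} {u} v⪯u)
      }
    }

  -- On true and On false are the letters that may be moved to the left and to the right
  -- of i: those below i go left iff α, those above i go left iff β.
  module Sides (i : Letter n) (α β : Bool) where

    data On (c : Bool) (j : Letter n) : Set where
      lower-side : toℕ j ℕ.< toℕ i → α ≡ c → On c j
      upper-side : toℕ i ℕ.< toℕ j → β ≡ c → On c j

    on-≢ : ∀ {c} {s : Word n} → All (On c) s → i ∉ s
    on-≢ (lower-side i<i _ ∷ _) (here refl) = ℕ.<-irrefl refl i<i
    on-≢ (upper-side i<i _ ∷ _) (here refl) = ℕ.<-irrefl refl i<i
    on-≢ (_ ∷ ons) (there i∈s) = on-≢ ons i∈s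

    -- The letters below i all share one side, and so do those above i. Hence letters of opposite
    -- sides have i strictly between them.
    on-commute : ∀ {k j} → On true k → On false j → Commute k j × Commute j k
    on-commute (lower-side _ refl) (lower-side _ ())
    on-commute {k} {j} (lower-side k<i _) (upper-side i<j _) =
      commute , λ x → sym (commute x)
      where commute = commute-distant k j (ℕ.<-≤-trans (s≤s k<i) i<j)
    on-commute {k} {j} (upper-side i<k _) (lower-side j<i _) = (λ x → sym (commute x)) , commute
      where commute = commute-distant j k (ℕ.<-≤-trans (s≤s j<i) i<k)
    on-commute (upper-side _ refl) (upper-side _ ())

    side : ∀ j → i ≢ j → On true j ⊎ On false j
    side j i≢j with ℕ.<-cmp (toℕ j) (toℕ i)
    ... | tri≈ _ eq _ = contradiction (sym (Fin.toℕ-injective eq)) i≢j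
    ... | tri< j<i _ _ = by-flag α refl
      where
      by-flag : ∀ c → α ≡ c → On true j ⊎ On false j
      by-flag true α≡ = inj₁ (lower-side j<i α≡)
      by-flag false α≡ = inj₂ (lower-side j<i α≡)
    ... | tri> _ _ i<j = by-flag β refl
      where
      by-flag : ∀ c → β ≡ c → On true j ⊎ On false j
      by-flag true β≡ = inj₁ (upper-side i<j β≡)
      by-flag false β≡ = inj₂ (upper-side i<j β≡)

    -- The lengths are recorded because they later show that the rearranged word is reduced.
    record Split (s : Word n) : Set where
      field
        {left right} : Word n
        left⊆ : left ⊆ s
        right⊆ : right ⊆ s
        left-on : All (On true) left
        right-on : All (On false) right
        length-split : length s ≡ length left ℕ.+ length right
        value : ∀ (x : Fin n) → ⟦ s ⟧ ⟨$⟩ʳ x ≡ ⟦ left ⟧ ⟨$⟩ʳ (⟦ right ⟧ ⟨$⟩ʳ x)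

    split : (s : Word n) → i ∉ s → Split s
    split [] _ = record
      { left⊆ = [] ; right⊆ = [] ; left-on = [] ; right-on = []
      ; length-split = refl ; value = λ _ → refl }
    split (k ∷ s) i∉ with split s (i∉ ∘ there) | side k (i∉ ∘ here)
    ... | S | inj₁ on = record
      { left⊆ = refl ∷ left⊆ ; right⊆ = k ∷ʳ right⊆
      ; left-on = on ∷ left-on ; right-on = right-on
      ; length-split = cong suc length-split ; value = λ x → cong (σ k ⟨$⟩ʳ_) (value x) }
      where open Split S
    ... | S | inj₂ on = record
      { left⊆ = k ∷ʳ left⊆ ; right⊆ = refl ∷ right⊆
      ; left-on = left-on ; right-on = on ∷ right-on
      ; length-split = trans (cong suc length-split) (sym (ℕ.+-suc _ _))
      -- The new letter belongs to the right factor and has to pass the left factor.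
      ; value = λ x → trans (cong (σ k ⟨$⟩ʳ_) (value x))
          (commute-word k (All.map (λ on′ → proj₂ (on-commute on′ on)) left-on) _) }
      where open Split S

    -- The factor iᵋ, with a Boolean exponent so that the exponents are ordered as in 𝟐.
    mid : Bool → Word n
    mid true = i ∷ []
    mid false = []

    mid-mono : ∀ {δ ε} → δ Bool.≤ ε → mid δ ⊆ mid ε
    mid-mono Bool.f≤t = i ∷ʳ []
    mid-mono Bool.b≤b = ⊆-refl

    ⊆-mid : ∀ {ε s} → s ⊆ mid ε → ∃[ δ ] (s ≡ mid δ × δ Bool.≤ ε)
    ⊆-mid {true} (_ ∷ʳ []) = false , refl , Bool.f≤t
    ⊆-mid {true} (refl ∷ []) = true , refl , Bool.b≤b
    ⊆-mid {false} [] = false , refl , Bool.b≤b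

    product : Word n → Bool → Word n → Word n
    product p ε q = p ++ mid ε ++ q

    ⟦product⟧ : ∀ p ε q (x : Fin n) →
      ⟦ product p ε q ⟧ ⟨$⟩ʳ x ≡ ⟦ p ⟧ ⟨$⟩ʳ (⟦ mid ε ⟧ ⟨$⟩ʳ (⟦ q ⟧ ⟨$⟩ʳ x))
    ⟦product⟧ p ε q x = trans (⟦⟧-++ p _ x) (cong (⟦ p ⟧ ⟨$⟩ʳ_) (⟦⟧-++ (mid ε) q x))

    ⊆-product : ∀ p ε q {s} → s ⊆ product p ε q →
      ∃[ p′ ] ∃[ δ ] ∃[ q′ ] (s ≡ product p′ δ q′ × p′ ⊆ p × δ Bool.≤ ε × q′ ⊆ q)
    ⊆-product p ε q s⊆
      with p′ , _ , refl , p′⊆p , s⊆′ ← ⊆-++⁻ p s⊆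
      with _ , q′ , refl , m⊆ , q′⊆q ← ⊆-++⁻ (mid ε) s⊆′
      with δ , refl , δ≤ε ← ⊆-mid m⊆
      = p′ , δ , q′ , refl , p′⊆p , δ≤ε , q′⊆q

    mid-fix : ∀ ε {x : Fin n} → x ≢ lo i → x ≢ hi i → ⟦ mid ε ⟧ ⟨$⟩ʳ x ≡ x
    mid-fix true x≢lo x≢hi = σ-fix i x≢lo x≢hi
    mid-fix false _ _ = refl

    letter<⇒moves< : (j : Letter n) {x : Fin n} → suc (toℕ j) ℕ.< toℕ x → x ≢ lo j × x ≢ hi j
    letter<⇒moves< j 1+j<x =
      (λ { refl → ℕ.<-asym (ℕ.n<1+n _) (subst (suc (toℕ j) ℕ.<_) (toℕ-lo j) 1+j<x) }) ,
      (λ { refl → ℕ.<-irrefl (sym (toℕ-hi j)) 1+j<x })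

    <letter⇒<moves : (j : Letter n) {x : Fin n} → toℕ x ℕ.< toℕ j → x ≢ lo j × x ≢ hi j
    <letter⇒<moves j x<j =
      (λ { refl → ℕ.<-irrefl (toℕ-lo j) x<j }) ,
      (λ { refl → ℕ.<-asym (ℕ.n<1+n _) (subst (ℕ._< toℕ j) (toℕ-hi j) x<j) })

    private
      Agree : (p p′ : Word n) → Fin n → Set
      Agree p p′ x = ⟦ p ⟧ ⟨$⟩ʳ x ≡ ⟦ p′ ⟧ ⟨$⟩ʳ x

      Avoids : Bool → Fin n → Set
      Avoids c x = ∀ j → On c j → x ≢ lo j × x ≢ hi j

      avoids-fix : ∀ {c x s} → Avoids c x → All (On c) s → ⟦ s ⟧ ⟨$⟩ʳ x ≡ x
      avoids-fix avoids ons = word-fix (All.map (λ {j} → avoids j) ons)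

    -- On every point but one, either both left factors are trivial, or the right factors are
    -- trivial on its preimage under the middle factor.
    product-left-unique : ∀ ε {p p′ q q′} → All (On true) p → All (On true) p′ →
      All (On false) q → All (On false) q′ →
      ⟦ product p ε q ⟧ ≈ ⟦ product p′ ε q′ ⟧ → ⟦ p ⟧ ≈ ⟦ p′ ⟧
    product-left-unique ε {p} {p′} {q} {q′} on-p on-p′ on-q on-q′ eq = by-flags α β refl refl
      where
      from-left : ∀ x → Avoids true x → Agree p p′ x
      from-left x avoids = trans (avoids-fix avoids on-p) (sym (avoids-fix avoids on-p′))

      from-right : ∀ y → Avoids false y → Agree p p′ (⟦ mid ε ⟧ ⟨$⟩ʳ y)
      from-right y avoids = begin
        ⟦ p ⟧ ⟨$⟩ʳ (⟦ mid ε ⟧ ⟨$⟩ʳ y)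
          ≡⟨ cong (λ z → ⟦ p ⟧ ⟨$⟩ʳ (⟦ mid ε ⟧ ⟨$⟩ʳ z)) (sym (avoids-fix avoids on-q)) ⟩
        ⟦ p ⟧ ⟨$⟩ʳ (⟦ mid ε ⟧ ⟨$⟩ʳ (⟦ q ⟧ ⟨$⟩ʳ y))
          ≡⟨ sym (⟦product⟧ p ε q y) ⟩
        ⟦ product p ε q ⟧ ⟨$⟩ʳ y
          ≡⟨ eq y ⟩
        ⟦ product p′ ε q′ ⟧ ⟨$⟩ʳ y
          ≡⟨ ⟦product⟧ p′ ε q′ y ⟩
        ⟦ p′ ⟧ ⟨$⟩ʳ (⟦ mid ε ⟧ ⟨$⟩ʳ (⟦ q′ ⟧ ⟨$⟩ʳ y))
          ≡⟨ cong (λ z → ⟦ p′ ⟧ ⟨$⟩ʳ (⟦ mid ε ⟧ ⟨$⟩ʳ z)) (avoids-fix avoids on-q′) ⟩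
        ⟦ p′ ⟧ ⟨$⟩ʳ (⟦ mid ε ⟧ ⟨$⟩ʳ y) ∎
        where open ≡-Reasoning

      from-right-fixed : ∀ x → x ≢ lo i → x ≢ hi i → Avoids false x → Agree p p′ x
      from-right-fixed x x≢lo x≢hi avoids =
        subst (Agree p p′) (mid-fix ε x≢lo x≢hi) (from-right x avoids)

      below-upper : ∀ {c x} → toℕ x ≤ toℕ i → (α ≡ c → ⊥) → Avoids c x
      below-upper x≤i α≢c j (lower-side _ α≡c) = ⊥-elim (α≢c α≡c)
      below-upper x≤i α≢c j (upper-side i<j _) = <letter⇒<moves j (ℕ.≤-<-trans x≤i i<j)

      above-lower : ∀ {c x} → toℕ i ℕ.< toℕ x → (β ≡ c → ⊥) → Avoids c x
      above-lower i<x β≢c j (upper-side _ β≡c) = ⊥-elim (β≢c β≡c)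
      above-lower i<x β≢c j (lower-side j<i _) = letter<⇒moves< j (ℕ.≤-<-trans j<i i<x)

      nowhere : ∀ {c x} → (α ≡ c → ⊥) → (β ≡ c → ⊥) → Avoids c x
      nowhere α≢c β≢c j (lower-side _ α≡c) = ⊥-elim (α≢c α≡c)
      nowhere α≢c β≢c j (upper-side _ β≡c) = ⊥-elim (β≢c β≡c)

      is : ∀ {b c d : Bool} → b ≡ c → c ≢ d → b ≡ d → ⊥
      is b≡c c≢d b≡d = c≢d (trans (sym b≡c) b≡d)

      by-flags : ∀ a b → α ≡ a → β ≡ b → ⟦ p ⟧ ≈ ⟦ p′ ⟧
      by-flags true true α≡ β≡ x =
        subst (Agree p p′) (inverseʳ ⟦ mid ε ⟧)
          (from-right _ (nowhere (is α≡ λ ()) (is β≡ λ ())))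
      by-flags false false α≡ β≡ x = from-left x (nowhere (is α≡ λ ()) (is β≡ λ ()))
      -- The point left out is the one that both the left factors and the middle factor may move:
      -- `lo i` when the left letters lie below i, `hi i` when they lie above.
      by-flags true false α≡ β≡ = ≈-except-one ⟦ p ⟧ ⟦ p′ ⟧ (lo i) away
        where
        away : ∀ x → x ≢ lo i → Agree p p′ x
        away x x≢lo with ℕ.<-cmp (toℕ x) (toℕ i)
        ... | tri< x<i _ _ = from-right-fixed x x≢lo
          (Fin.<⇒≢ (Fin.<-trans (subst (toℕ x ℕ.<_) (sym (toℕ-lo i)) x<i) (lo<hi i)))
          (below-upper (ℕ.<⇒≤ x<i) (is α≡ λ ()))
        ... | tri≈ _ x≡i _ = contradiction (Fin.toℕ-injective (trans x≡i (sym (toℕ-lo i)))) x≢lo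
        ... | tri> _ _ i<x = from-left x (above-lower i<x (is β≡ λ ()))
      by-flags false true α≡ β≡ = ≈-except-one ⟦ p ⟧ ⟦ p′ ⟧ (hi i) away
        where
        away : ∀ x → x ≢ hi i → Agree p p′ x
        away x x≢hi with toℕ x ℕ.≤? toℕ i
        ... | yes x≤i = from-left x (below-upper x≤i (is α≡ λ ()))
        ... | no x≰i = from-right-fixed x
          (λ { refl → x≰i (ℕ.≤-reflexive (toℕ-lo i)) }) x≢hi
          (above-lower (ℕ.≰⇒> x≰i) (is β≡ λ ()))

    product-unique-same : ∀ ε {p p′ q q′} → All (On true) p → All (On true) p′ →
      All (On false) q → All (On false) q′ → ⟦ product p ε q ⟧ ≈ ⟦ product p′ ε q′ ⟧ →
      ε ≡ ε × ⟦ p ⟧ ≈ ⟦ p′ ⟧ × ⟦ q ⟧ ≈ ⟦ q′ ⟧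
    product-unique-same ε {p} {p′} {q} {q′} on-p on-p′ on-q on-q′ eq =
      refl , p≈p′ , λ x → ⟨$⟩ʳ-injective ⟦ mid ε ⟧ (⟨$⟩ʳ-injective ⟦ p ⟧
        (trans (sym (⟦product⟧ p ε q x))
          (trans (eq x) (trans (⟦product⟧ p′ ε q′ x) (sym (p≈p′ _))))))
      where
      p≈p′ : ⟦ p ⟧ ≈ ⟦ p′ ⟧
      p≈p′ = product-left-unique ε on-p on-p′ on-q on-q′ eq

    -- Different exponents are excluded by `∉-≉`, as i would occur once in one product and not at
    -- all in the other. For equal exponents the left factors agree, and cancelling gives the right
    -- ones.
    product-unique : ∀ {ε ε′ p p′ q q′} → All (On true) p → All (On true) p′ →
      All (On false) q → All (On false) q′ → ⟦ product p ε q ⟧ ≈ ⟦ product p′ ε′ q′ ⟧ →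
      ε ≡ ε′ × ⟦ p ⟧ ≈ ⟦ p′ ⟧ × ⟦ q ⟧ ≈ ⟦ q′ ⟧
    product-unique {true} {false} {p} {p′} {q} {q′} on-p on-p′ on-q on-q′ eq =
      ⊥-elim (∉-≉ i p q (p′ ++ q′) (on-≢ on-p) (on-≢ on-q) i∉p′q′ eq)
      where
      i∉p′q′ : i ∉ p′ ++ q′
      i∉p′q′ = λ i∈ → Sum.[ on-≢ on-p′ , on-≢ on-q′ ] (∈-++⁻ p′ i∈)
    product-unique {false} {true} {p} {p′} {q} {q′} on-p on-p′ on-q on-q′ eq =
      ⊥-elim (∉-≉ i p′ q′ (p ++ q) (on-≢ on-p′) (on-≢ on-q′) i∉pq (sym ∘ eq))
      where
      i∉pq : i ∉ p ++ q
      i∉pq = λ i∈ → Sum.[ on-≢ on-p , on-≢ on-q ] (∈-++⁻ p i∈)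
    product-unique {true} {true} on-p on-p′ on-q on-q′ eq =
      product-unique-same true on-p on-p′ on-q on-q′ eq
    product-unique {false} {false} on-p on-p′ on-q on-q′ eq =
      product-unique-same false on-p on-p′ on-q on-q′ eq

    -- The isomorphism of B(w) with 𝟐 × B(p) × B(q)

    module Isomorphism (w : Permutation′ n) (p q : Word n)
      (on-p : All (On true) p) (on-q : All (On false) q)
      (red : Reduced (product p true q)) (piq≈w : ⟦ product p true q ⟧ ≈ w) where

      X : Poset 0ℓ 0ℓ 0ℓ
      X = ×-poset (bruhatPoset ⟦ p ⟧) (bruhatPoset ⟦ q ⟧)

      private
        module 𝟐×X = Poset (×-poset Bool.≤-poset X)

        -- Taking the factors as subwords of `p` and `q` gives both the side of their letters and
        -- their membership in B(p) and B(q).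
        record Factorization (u : Permutation′ n) : Set where
          field
            {left right} : Word n
            {middle} : Bool
            left⊆ : left ⊆ p
            right⊆ : right ⊆ q
            reduced : Reduced (product left middle right)
            value : ⟦ product left middle right ⟧ ≈ u
        open Factorization

        reduced-left : ∀ {u} (F : Factorization u) → Reduced (left F)
        reduced-left F = reduced-++ˡ (left F) _ (reduced F)

        reduced-right : ∀ {u} (F : Factorization u) → Reduced (right F)
        reduced-right F =
          reduced-++ʳ (mid (middle F)) (right F) (reduced-++ʳ (left F) _ (reduced F))

        factorize : ∀ {u} → u ≼ w → Factorization u
        factorize u≼w
          with s , s⊆ , s≈u ← ≼⇒⊆ u≼w (product p true q) piq≈w
          with r , r⊆s , r≈s , red-r ← reduce s
          with p′ , ε , q′ , refl , p′⊆p , _ , q′⊆q ← ⊆-product p true q (⊆-trans r⊆s s⊆)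
          = record { left⊆ = p′⊆p ; right⊆ = q′⊆q ; reduced = red-r
                   ; value = λ x → trans (r≈s x) (s≈u x) }

        toProduct : ∀ {u} → Factorization u → 𝟐×X.Carrier
        toProduct F =
          middle F ,
          (⟦ left F ⟧ , ≼⇒⪯ (⊆⇒≼ (reduced-++ˡ p _ red) (left⊆ F))) ,
          (⟦ right F ⟧ , ≼⇒⪯ (⊆⇒≼ (reduced-++ʳ (i ∷ []) q (reduced-++ʳ p _ red)) (right⊆ F)))

        -- By the subword property u is a product of subwords of the factors of v, and uniqueness
        -- identifies these with the factors of u. With arbitrary `F` and `G`, this also shows that
        -- the image does not depend on the factorization.
        toProduct-mono : ∀ {u v} (F : Factorization u) (G : Factorization v) → u ≼ v →
          toProduct F 𝟐×X.≤ toProduct G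
        toProduct-mono F G u≼v
          with s , s⊆ , s≈u ← ≼⇒⊆ u≼v (product (left G) (middle G) (right G)) (value G)
          with l , δ , r , refl , l⊆ , δ≤ , r⊆ ← ⊆-product (left G) (middle G) (right G) s⊆
          with refl , l≈ , r≈ ← product-unique {δ} {middle F}
            (All-resp-⊆ (⊆-trans l⊆ (left⊆ G)) on-p) (All-resp-⊆ (left⊆ F) on-p)
            (All-resp-⊆ (⊆-trans r⊆ (right⊆ G)) on-q) (All-resp-⊆ (right⊆ F) on-q)
            (λ x → trans (s≈u x) (sym (value F x)))
          = δ≤ ,
            ≼⇒⪯ {⟦ left F ⟧} {⟦ left G ⟧} (≼-respˡ l≈ (⊆⇒≼ (reduced-left G) l⊆)) ,
            ≼⇒⪯ {⟦ right F ⟧} {⟦ right G ⟧} (≼-respˡ r≈ (⊆⇒≼ (reduced-right G) r⊆))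

        -- The outer factors of `F` are replaced by equal permutations written as subwords of those
        -- of `G`; concatenation then gives a subword of a reduced word of v.
        toProduct-cancel : ∀ {u v} (F : Factorization u) (G : Factorization v) →
          toProduct F 𝟐×X.≤ toProduct G → u ≼ v
        toProduct-cancel {u} F G (ε≤ , left⪯ , right⪯)
          with l , l⊆ , l≈ ← ≼⇒⊆ (⪯⇒≼ {⟦ left F ⟧} {⟦ left G ⟧} left⪯) (left G) (λ _ → refl)
          with r , r⊆ , r≈ ← ≼⇒⊆ (⪯⇒≼ {⟦ right F ⟧} {⟦ right G ⟧} right⪯) (right G) (λ _ → refl)
          = ≼-respˡ lr≈u
            (≼-trans (⊆⇒≼ (reduced G) (++⁺ l⊆ (++⁺ (mid-mono ε≤) r⊆))) (equal (value G)))
          where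
          lr≈u : ⟦ product l (middle F) r ⟧ ≈ u
          lr≈u x = begin
            ⟦ product l (middle F) r ⟧ ⟨$⟩ʳ x
              ≡⟨ ⟦product⟧ l (middle F) r x ⟩
            ⟦ l ⟧ ⟨$⟩ʳ (⟦ mid (middle F) ⟧ ⟨$⟩ʳ (⟦ r ⟧ ⟨$⟩ʳ x))
              ≡⟨ l≈ _ ⟩
            ⟦ left F ⟧ ⟨$⟩ʳ (⟦ mid (middle F) ⟧ ⟨$⟩ʳ (⟦ r ⟧ ⟨$⟩ʳ x))
              ≡⟨ cong (λ y → ⟦ left F ⟧ ⟨$⟩ʳ (⟦ mid (middle F) ⟧ ⟨$⟩ʳ y)) (r≈ x) ⟩
            ⟦ left F ⟧ ⟨$⟩ʳ (⟦ mid (middle F) ⟧ ⟨$⟩ʳ (⟦ right F ⟧ ⟨$⟩ʳ x))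
              ≡⟨ sym (⟦product⟧ (left F) (middle F) (right F) x) ⟩
            ⟦ product (left F) (middle F) (right F) ⟧ ⟨$⟩ʳ x
              ≡⟨ value F x ⟩
            u ⟨$⟩ʳ x ∎
            where open ≡-Reasoning

        factorization : (u : B w) → Factorization (proj₁ u)
        factorization (u , u⪯w) = factorize (⪯⇒≼ {u} {w} u⪯w)

        f : B w → 𝟐×X.Carrier
        f u = toProduct (factorization u)

        f-mono : (u v : B w) → proj₁ u ⪯ proj₁ v → f u 𝟐×X.≤ f v
        f-mono u v u⪯v =
          toProduct-mono (factorization u) (factorization v) (⪯⇒≼ {proj₁ u} {proj₁ v} u⪯v)

        f-cancel-≼ : (u v : B w) → f u 𝟐×X.≤ f v → proj₁ u ≼ proj₁ v
        f-cancel-≼ u v = toProduct-cancel (factorization u) (factorization v)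

        f-cong : (u v : B w) → proj₁ u ≈ proj₁ v → f u 𝟐×X.≈ f v
        f-cong u v u≈v = 𝟐×X.antisym {f u} {f v}
          (toProduct-mono (factorization u) (factorization v) (equal u≈v))
          (toProduct-mono (factorization v) (factorization u) (equal (sym ∘ u≈v)))

        f-injective : (u v : B w) → f u 𝟐×X.≈ f v → proj₁ u ≈ proj₁ v
        f-injective u v fu≈fv = ≼-antisym
          (f-cancel-≼ u v (𝟐×X.reflexive {f u} {f v} fu≈fv))
          (f-cancel-≼ v u (𝟐×X.reflexive {f v} {f u} (𝟐×X.Eq.sym {f u} {f v} fu≈fv)))

        -- The preimage is a subword of p i q, but perhaps not a reduced one; uniqueness compares it
        -- with the factorization that `f` uses.
        f-surjective : ∀ y → Σ[ u ∈ B w ] (∀ {v : B w} → proj₁ v ≈ proj₁ u → f v 𝟐×X.≈ y)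
        f-surjective (ε , (x , x⪯p) , (y , y⪯q))
          with l , l⊆ , l≈ ← ≼⇒⊆ (⪯⇒≼ {x} {⟦ p ⟧} x⪯p) p (λ _ → refl)
          with r , r⊆ , r≈ ← ≼⇒⊆ (⪯⇒≼ {y} {⟦ q ⟧} y⪯q) q (λ _ → refl)
          = (⟦ product l ε r ⟧ , ≼⇒⪯ {⟦ product l ε r ⟧} {w} (≼-trans
              (⊆⇒≼ red (++⁺ l⊆ (++⁺ (mid-mono (Bool.≤-maximum ε)) r⊆))) (equal piq≈w))) ,
            λ {v} → value-unique (factorization v)
          where
          value-unique : ∀ {v} (F : Factorization v) → v ≈ ⟦ product l ε r ⟧ →
            toProduct F 𝟐×X.≈ (ε , (x , x⪯p) , (y , y⪯q))
          value-unique F v≈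
            with refl , left≈ , right≈ ← product-unique {middle F} {ε}
              (All-resp-⊆ (left⊆ F) on-p) (All-resp-⊆ l⊆ on-p)
              (All-resp-⊆ (right⊆ F) on-q) (All-resp-⊆ r⊆ on-q)
              (λ x → trans (value F x) (v≈ x))
            = refl , (λ x → trans (left≈ x) (l≈ x)) , (λ x → trans (right≈ x) (r≈ x))

      isPrism : IsPrism w
      isPrism = X , f , record
        { isOrderMonomorphism = record
          { isOrderHomomorphism = record
            { cong = λ {u} {v} → f-cong u v
            ; mono = λ {u} {v} → f-mono u v
            }
          ; injective = λ {u} {v} → f-injective u v
          ; cancel = λ {u} {v} fu≤fv → ≼⇒⪯ (f-cancel-≼ u v fu≤fv)
          }
        ; surjective = f-surjective
        }

    -- Moving letters across i

    rearrange : ∀ {a b} (A : Split a) (B : Split b) →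
      All (λ j → Commute i j) (Split.left B) → All (λ j → Commute i j) (Split.right A) →
      ⟦ a ++ i ∷ b ⟧ ≈
        ⟦ product (Split.left A ++ Split.left B) true (Split.right A ++ Split.right B) ⟧
    rearrange {a} {b} A B i-bˡ i-aʳ x = begin
      ⟦ a ++ i ∷ b ⟧ ⟨$⟩ʳ x
        ≡⟨ ⟦⟧-++ a (i ∷ b) x ⟩
      ⟦ a ⟧ ⟨$⟩ʳ (σ i ⟨$⟩ʳ (⟦ b ⟧ ⟨$⟩ʳ x))
        ≡⟨ A.value _ ⟩
      ⟦ A.left ⟧ ⟨$⟩ʳ (⟦ A.right ⟧ ⟨$⟩ʳ (σ i ⟨$⟩ʳ (⟦ b ⟧ ⟨$⟩ʳ x)))
        ≡⟨ cong (λ y → ⟦ A.left ⟧ ⟨$⟩ʳ (⟦ A.right ⟧ ⟨$⟩ʳ (σ i ⟨$⟩ʳ y))) (B.value x) ⟩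
      ⟦ A.left ⟧ ⟨$⟩ʳ (⟦ A.right ⟧ ⟨$⟩ʳ (σ i ⟨$⟩ʳ (⟦ B.left ⟧ ⟨$⟩ʳ (⟦ B.right ⟧ ⟨$⟩ʳ x))))
        -- The left part of b passes i and then the right part of a; after that the right part of a
        -- passes i.
        ≡⟨ cong (λ y → ⟦ A.left ⟧ ⟨$⟩ʳ (⟦ A.right ⟧ ⟨$⟩ʳ y)) (commute-word i i-bˡ _) ⟩
      ⟦ A.left ⟧ ⟨$⟩ʳ (⟦ A.right ⟧ ⟨$⟩ʳ (⟦ B.left ⟧ ⟨$⟩ʳ (σ i ⟨$⟩ʳ (⟦ B.right ⟧ ⟨$⟩ʳ x))))
        ≡⟨ cong (⟦ A.left ⟧ ⟨$⟩ʳ_) (commute-words aʳ-bˡ _) ⟩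
      ⟦ A.left ⟧ ⟨$⟩ʳ (⟦ B.left ⟧ ⟨$⟩ʳ (⟦ A.right ⟧ ⟨$⟩ʳ (σ i ⟨$⟩ʳ (⟦ B.right ⟧ ⟨$⟩ʳ x))))
        ≡⟨ cong (λ y → ⟦ A.left ⟧ ⟨$⟩ʳ (⟦ B.left ⟧ ⟨$⟩ʳ y)) (sym (commute-word i i-aʳ _)) ⟩
      ⟦ A.left ⟧ ⟨$⟩ʳ (⟦ B.left ⟧ ⟨$⟩ʳ (σ i ⟨$⟩ʳ (⟦ A.right ⟧ ⟨$⟩ʳ (⟦ B.right ⟧ ⟨$⟩ʳ x))))
        ≡⟨ cong (λ y → ⟦ A.left ⟧ ⟨$⟩ʳ (⟦ B.left ⟧ ⟨$⟩ʳ (σ i ⟨$⟩ʳ y)))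
            (sym (⟦⟧-++ A.right B.right x)) ⟩
      ⟦ A.left ⟧ ⟨$⟩ʳ (⟦ B.left ⟧ ⟨$⟩ʳ (σ i ⟨$⟩ʳ (⟦ A.right ++ B.right ⟧ ⟨$⟩ʳ x)))
        ≡⟨ sym (⟦⟧-++ A.left B.left _) ⟩
      ⟦ A.left ++ B.left ⟧ ⟨$⟩ʳ (σ i ⟨$⟩ʳ (⟦ A.right ++ B.right ⟧ ⟨$⟩ʳ x))
        ≡⟨ sym (⟦product⟧ (A.left ++ B.left) true (A.right ++ B.right) x) ⟩
      ⟦ product (A.left ++ B.left) true (A.right ++ B.right) ⟧ ⟨$⟩ʳ x ∎
      where
      open ≡-Reasoning
      module A = Split A
      module B = Split B
      aʳ-bˡ : All (λ k → All (Commute k) B.left) A.right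
      aʳ-bˡ = All.map
        (λ on-k → All.map (λ on-j → proj₂ (on-commute on-j on-k)) B.left-on) A.right-on

    length-rearrange : ∀ {a b} (A : Split a) (B : Split b) →
      length (product (Split.left A ++ Split.left B) true (Split.right A ++ Split.right B)) ≡
        length (a ++ i ∷ b)
    length-rearrange {a} {b} A B = begin
      length ((A.left ++ B.left) ++ i ∷ (A.right ++ B.right))
        ≡⟨ length-++ (A.left ++ B.left) ⟩
      length (A.left ++ B.left) ℕ.+ suc (length (A.right ++ B.right))
        ≡⟨ cong₂ (λ x y → x ℕ.+ suc y) (length-++ A.left) (length-++ A.right) ⟩
      (length A.left ℕ.+ length B.left) ℕ.+ suc (length A.right ℕ.+ length B.right)
        ≡⟨ interchange (length A.left) (length B.left) (length A.right) (length B.right) ⟩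
      (length A.left ℕ.+ length A.right) ℕ.+ suc (length B.left ℕ.+ length B.right)
        ≡⟨ sym (cong₂ (λ x y → x ℕ.+ suc y) A.length-split B.length-split) ⟩
      length a ℕ.+ suc (length b)
        ≡⟨ sym (length-++ a) ⟩
      length (a ++ i ∷ b) ∎
      where
      open ≡-Reasoning
      module A = Split A
      module B = Split B
      interchange : ∀ a b c d → (a ℕ.+ b) ℕ.+ suc (c ℕ.+ d) ≡ (a ℕ.+ c) ℕ.+ suc (b ℕ.+ d)
      interchange = solve-∀

  -- A flag is true when the neighbour of i it governs may occur in a but not in b.
  neighbour-side : (R : Letter n → Set) → (∀ j → Dec (R j)) → (∀ {j k} → R j → R k → j ≡ k) →
    (a b : Word n) → (∀ j → R j → ¬ (j ∈ a × j ∈ b)) →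
    ∃[ c ] ((c ≡ true → ∀ {j} → j ∈ b → ¬ R j) × (c ≡ false → ∀ {j} → j ∈ a → ¬ R j))
  neighbour-side R R? R-unique a b separated with any? R? a
  -- The default, which also covers a neighbour that is not a letter.
  ... | no none = false , (λ ()) , λ _ j∈a Rj → none (lose j∈a Rj)
  ... | yes some with k , k∈a , Rk ← find some =
    true , (λ _ j∈b Rj → separated k Rk (k∈a , subst (_∈ b) (R-unique Rj Rk) j∈b)) , λ ()

  unconfined⇒prism : (w : Permutation′ n) (i : Letter n) (s : Word n) → IsReducedWord s w →
    UnconfinedIn i s → IsPrism w
  unconfined⇒prism w i s s-word@(s≈w , _) (a , b , refl , i∉a , i∉b , upper , lower)
    with α , α-true , α-false ← neighbour-side (λ j → suc (toℕ j) ≡ toℕ i)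
      (λ j → suc (toℕ j) ℕ.≟ toℕ i)
      (λ j≡ k≡ → Fin.toℕ-injective (ℕ.suc-injective (trans j≡ (sym k≡)))) a b lower
    with β , β-true , β-false ← neighbour-side (λ j → toℕ j ≡ suc (toℕ i))
      (λ j → toℕ j ℕ.≟ suc (toℕ i))
      (λ j≡ k≡ → Fin.toℕ-injective (trans j≡ (sym k≡))) a b upper
    = Isomorphism.isPrism w (A.left ++ B.left) (A.right ++ B.right)
        (All.++⁺ A.left-on B.left-on) (All.++⁺ A.right-on B.right-on)
        -- The rearranged word is as long as the given reduced word, hence reduced.
        (λ r r≈ → subst (_≤ length r) (sym (length-rearrange splitA splitB))
          (isReducedWord⇒Reduced (a ++ i ∷ b) w s-word r λ x → trans (r≈ x) (sym (rearranged x))))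
        (λ x → trans (sym (rearranged x)) (s≈w x))
    where
    open Sides i α β
    splitA : Split a
    splitA = split a i∉a
    splitB : Split b
    splitB = split b i∉b
    module A = Split splitA
    module B = Split splitB

    -- Being strictly on one side of i and not a neighbour puts j at distance at least 2.
    commute-i : ∀ {c j} → On c j → (α ≡ c → suc (toℕ j) ≢ toℕ i) →
      (β ≡ c → toℕ j ≢ suc (toℕ i)) → Commute i j
    commute-i {j = j} (lower-side j<i α≡c) not-lower _ x =
      sym (commute-distant j i (ℕ.≤∧≢⇒< j<i (not-lower α≡c)) x)
    commute-i {j = j} (upper-side i<j β≡c) _ not-upper =
      commute-distant i j (ℕ.≤∧≢⇒< i<j (not-upper β≡c ∘ sym))

    rearranged : ⟦ a ++ i ∷ b ⟧ ≈ ⟦ product (A.left ++ B.left) true (A.right ++ B.right) ⟧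
    rearranged = rearrange splitA splitB
      (All.tabulate λ j∈ → commute-i (All.lookup B.left-on j∈)
        (λ α≡ → α-true α≡ (Any-resp-⊆ B.left⊆ j∈)) (λ β≡ → β-true β≡ (Any-resp-⊆ B.left⊆ j∈)))
      (All.tabulate λ j∈ → commute-i (All.lookup A.right-on j∈)
        (λ α≡ → α-false α≡ (Any-resp-⊆ A.right⊆ j∈)) (λ β≡ → β-false β≡ (Any-resp-⊆ A.right⊆ j∈)))

theorem2p11 : ∀ (n : ℕ) (w : Permutation′ n) →
    (IsPrism w ⇔ (∃[ i ] (i ∈supp w × Unconfined i w)))
    × (IsPrism w ⇔ (∃[ i ] ∃[ s ] (IsReducedWord s w × UnconfinedIn i s)))
theorem2p11 n w =
  mk⇔ (λ prism → with-support (Prism.unconfined-letter w prism))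
      (λ (i , _ , s , s-word , unconfined) → unconfined⇒prism w i s s-word unconfined) ,
  mk⇔ (Prism.unconfined-letter w)
      (λ (i , s , s-word , unconfined) → unconfined⇒prism w i s s-word unconfined)
  where
  with-support : ∃[ i ] ∃[ s ] (IsReducedWord s w × UnconfinedIn i s) →
    ∃[ i ] (i ∈supp w × Unconfined i w)
  with-support (i , s , s-word , unconfined@(a , b , refl , _)) =
    i , (s , s-word , ∈-insert a) , (s , s-word , unconfined)
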